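{- Let $p(x)=x^3-ax^2-bx-1$ be a polynomial with integer coefficients $a,b$ satisfying ($a\ge0$ and $0\le b\le a+1$) or ($a\ge2$ and $b=-1$). Assume that $p$ has a unique real root $\beta$ and that $\beta>1$. Then the set $\{\langle\!\langle\beta^n\rangle\!\rangle : n\ge0\}$ is generalised polynomial, where $\langle\!\langle r\rangle\!\rangle=\lfloor r+1/2\rfloor$ denotes the nearest integer to $r$.
   Context: The family of generalised polynomials is the smallest set of functions $\mathbb{Z}\to\mathbb{R}$ containing the polynomial maps and closed under addition, multiplication and the operation of taking the integer part $\lfloor\cdot\rfloor$. A set $E\subset\mathbb{Z}$ is called generalised polynomial if its characteristic function is a generalised polynomial. -}

module Defs where

open import Level using (0ℓ; suc)
open import Algebra.Bundles using (CommutativeRing)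
open import Data.Empty using (⊥-elim)
open import Data.Integer.Base as ℤ using (ℤ; +_; -[1+_])
import Data.Integer.Properties as ℤₚ
open import Data.Integer.Tactic.RingSolver using (solve-∀)
open import Data.List.Base using (List; foldr)
open import Data.Nat.Base as ℕ using (ℕ; zero)
open import Data.Product.Base using (∃; ∃-syntax; _×_; _,_; proj₁; proj₂)
open import Data.Sum.Base using (_⊎_; inj₁; inj₂)
open import Relation.Binary.Core using (Rel)
open import Relation.Binary.Definitions using (tri<; tri≈; tri>)
open import Relation.Binary.PropositionalEquality as ≡ using (_≡_)
open import Relation.Binary.Structures using (IsStrictTotalOrder)
open import Relation.Nullary using (¬_; Dec; yes; no)
open import Relation.Unary using (Pred; _∈_; _∉_; Satisfiable)
import Algebra.Definitions.RawMonoid as RawMult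
import Algebra.Properties.Ring as RingProperties
import Algebra.Properties.Semiring.Exp as Exp
import Relation.Binary.Construct.StrictToNonStrict as NonStrict

-- ℝ is characterised up to isomorphism as the Dedekind-complete ordered field.
-- The axioms are the classical ones: the order is trichotomous, and suprema
-- satisfy the ε-characterisation.  Together they yield excluded middle for
-- small types (`excludedMiddle` below), so that statements about such a field
-- have their usual classical meaning.
record CompleteOrderedField : Set (suc 0ℓ) where
  infix  4 _<_ _≤_
  infix  8 _⁻¹
  field
    commutativeRing : CommutativeRing 0ℓ 0ℓ

  open CommutativeRing commutativeRing public

  field
    _<_                : Rel Carrier 0ℓ
    isStrictTotalOrder : IsStrictTotalOrder _≈_ _<_
    +-monoˡ-<          : ∀ {x y} z → x < y → x + z < y + z
    *-pos              : ∀ {x y} → 0# < x → 0# < y → 0# < x * y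
    0≉1                : ¬ 0# ≈ 1#
    -- The value of 0# ⁻¹ is unspecified.
    _⁻¹                : Carrier → Carrier
    *-inverseʳ         : ∀ x → ¬ x ≈ 0# → x * x ⁻¹ ≈ 1#

  _≤_ : Rel Carrier 0ℓ
  _≤_ = NonStrict._≤_ _≈_ _<_

  UpperBound : Pred Carrier 0ℓ → Pred Carrier 0ℓ
  UpperBound S u = ∀ x → x ∈ S → x ≤ u

  IsSupremum : Pred Carrier 0ℓ → Pred Carrier 0ℓ
  IsSupremum S s = UpperBound S s × (∀ y → y < s → ∃[ x ] x ∈ S × y < x)

  field
    complete : (S : Pred Carrier 0ℓ) → Satisfiable S → Satisfiable (UpperBound S) →
               Satisfiable (IsSupremum S)

  open IsStrictTotalOrder isStrictTotalOrder public
    using (compare; irrefl; <-respˡ-≈; <-respʳ-≈)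
    renaming (trans to <-trans)

module Real (ℝ : CompleteOrderedField) where

  open CompleteOrderedField ℝ public
  open Exp semiring public using (_^_)
  open RingProperties ring using (-‿involutive; -‿distribˡ-*)
  open RawMult +-rawMonoid using () renaming (_×_ to _·_)

  fromℤ : ℤ → Carrier
  fromℤ (+ n)    = n · 1#
  fromℤ -[1+ n ] = - (ℕ.suc n · 1#)

  private

    <-irr : ∀ {x} → ¬ x < x
    <-irr = irrefl refl

    ≤-<-trans : ∀ {x y z} → x ≤ y → y < z → x < z
    ≤-<-trans (inj₁ x<y) y<z = <-trans x<y y<z
    ≤-<-trans (inj₂ x≈y) y<z = <-respˡ-≈ (sym x≈y) y<z

    ≮⇒≥ : ∀ {x y} → ¬ x < y → y ≤ x
    ≮⇒≥ {x} {y} x≮y with compare x y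
    ... | tri< x<y _ _ = ⊥-elim (x≮y x<y)
    ... | tri≈ _ x≈y _ = inj₂ (sym x≈y)
    ... | tri> _ _ y<x = inj₁ y<x

    neg-anti : ∀ {x y} → x < y → - y < - x
    neg-anti {x} {y} x<y =
      <-respˡ-≈ left (<-respʳ-≈ right (+-monoˡ-< (- x + - y) x<y))
      where
      left : x + (- x + - y) ≈ - y
      left = trans (sym (+-assoc x (- x) (- y)))
                   (trans (+-congʳ (-‿inverseʳ x)) (+-identityˡ (- y)))
      right : y + (- x + - y) ≈ - x
      right = trans (+-congˡ (+-comm (- x) (- y)))
                    (trans (sym (+-assoc y (- y) (- x)))
                           (trans (+-congʳ (-‿inverseʳ y)) (+-identityˡ (- x))))

    -0≈0 : - 0# ≈ 0#
    -0≈0 = trans (sym (+-identityˡ (- 0#))) (-‿inverseʳ 0#)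

    0<1 : 0# < 1#
    0<1 with compare 0# 1#
    ... | tri< 0<1 _ _ = 0<1
    ... | tri≈ _ 0≈1 _ = ⊥-elim (0≉1 0≈1)
    ... | tri> _ _ 1<0 = <-respʳ-≈ square (*-pos 0<-1 0<-1)
      where
      0<-1 : 0# < - 1#
      0<-1 = <-respˡ-≈ -0≈0 (neg-anti 1<0)
      square : - 1# * - 1# ≈ 1#
      square = trans (sym (-‿distribˡ-* 1# (- 1#)))
                     (trans (-‿cong (*-identityˡ (- 1#))) (-‿involutive 1#))

  excludedMiddle : (P : Set) → Dec P
  excludedMiddle P with complete S (0# , inj₁ refl) (1# , bound)
    where
    S : Pred Carrier 0ℓ
    S x = x ≈ 0# ⊎ (x ≈ 1# × P)
    bound : UpperBound S 1#
    bound x (inj₁ x≈0)       = inj₁ (<-respˡ-≈ (sym x≈0) 0<1)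
    bound x (inj₂ (x≈1 , _)) = inj₂ x≈1
  ... | s , upper , approx with compare 0# s
  ...   | tri≈ _ 0≈s _ = no λ p → <-irr (<-respʳ-≈ (sym 0≈s) (<-s p))
    where
    <-s : P → 0# < s
    <-s p with upper 1# (inj₂ (refl , p))
    ... | inj₁ 1<s = <-trans 0<1 1<s
    ... | inj₂ 1≈s = <-respʳ-≈ 1≈s 0<1
  ...   | tri> _ _ s<0 = no λ _ → <-irr (≤-<-trans (upper 0# (inj₁ refl)) s<0)
  ...   | tri< 0<s _ _ with approx 0# 0<s
  ...     | x , inj₁ x≈0       , 0<x = ⊥-elim (<-irr (<-respʳ-≈ x≈0 0<x))
  ...     | x , inj₂ (_ , p)   , 0<x = yes p

  archimedean : ∀ x → ∃[ n ] x < fromℤ (+ n)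
  archimedean x with excludedMiddle (∃[ n ] x < fromℤ (+ n))
  ... | yes found = found
  ... | no  none with complete S (0# , 0 , refl) (x , bound)
    where
    S : Pred Carrier 0ℓ
    S y = ∃[ n ] y ≈ fromℤ (+ n)
    bound : UpperBound S x
    bound y (n , y≈n) with ≮⇒≥ (λ x<n → none (n , x<n))
    ... | inj₁ n<x = inj₁ (<-respˡ-≈ (sym y≈n) n<x)
    ... | inj₂ n≈x = inj₂ (trans y≈n n≈x)
  ...   | s , upper , approx with approx (- 1# + s) s-1<s
    where
    s-1<s : - 1# + s < s
    s-1<s = <-respʳ-≈ (+-identityˡ s)
              (+-monoˡ-< s (<-respʳ-≈ -0≈0 (neg-anti 0<1)))
  ...     | y , (n , y≈n) , s-1<y =
    ⊥-elim (<-irr (≤-<-trans (upper (1# + fromℤ (+ n)) (ℕ.suc n , refl)) s<1+n))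
    where
    left : (- 1# + s) + 1# ≈ s
    left = trans (+-comm (- 1# + s) 1#)
                 (trans (sym (+-assoc 1# (- 1#) s))
                        (trans (+-congʳ (-‿inverseʳ 1#)) (+-identityˡ s)))
    s<1+n : s < 1# + fromℤ (+ n)
    s<1+n = <-respˡ-≈ left
              (<-respʳ-≈ (trans (+-congʳ y≈n) (+-comm (fromℤ (+ n)) 1#))
                (+-monoˡ-< 1# s-1<y))

  IsFloor : Carrier → Pred ℤ 0ℓ
  IsFloor x k = fromℤ k ≤ x × x < fromℤ (ℤ.suc k)

  private

    shift : ∀ i j → i ℤ.+ (+ 1 ℤ.+ j) ≡ (+ 1 ℤ.+ i) ℤ.+ j
    shift = solve-∀

    search : ∀ x n k → fromℤ k ≤ x → x < fromℤ (k ℤ.+ + n) → ∃ (IsFloor x)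
    search x zero k k≤x x<k =
      ⊥-elim (<-irr (≤-<-trans k≤x
        (≡.subst (λ i → x < fromℤ i) (ℤₚ.+-identityʳ k) x<k)))
    search x (ℕ.suc n) k k≤x x<k+n with compare x (fromℤ (ℤ.suc k))
    ... | tri< x<k+1 _ _ = k , k≤x , x<k+1
    ... | tri≈ _ x≈k+1 _ = search x n (ℤ.suc k) (inj₂ (sym x≈k+1))
                             (≡.subst (λ i → x < fromℤ i) (shift k (+ n)) x<k+n)
    ... | tri> _ _ k+1<x = search x n (ℤ.suc k) (inj₁ k+1<x)
                             (≡.subst (λ i → x < fromℤ i) (shift k (+ n)) x<k+n)

    fromℤ-neg : ∀ n → fromℤ (ℤ.- (+ n)) ≈ - fromℤ (+ n)
    fromℤ-neg zero      = sym -0≈0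
    fromℤ-neg (ℕ.suc n) = refl

  floor : ∀ x → ∃ (IsFloor x)
  floor x with archimedean x | archimedean (- x)
  ... | m , x<m | l , -x<l =
    search x (l ℕ.+ m) (ℤ.- (+ l)) (inj₁ -l<x)
      (≡.subst (λ i → x < fromℤ i) (≡.sym (cancel (+ l) (+ m))) x<m)
    where
    -l<x : fromℤ (ℤ.- (+ l)) < x
    -l<x = <-respˡ-≈ (sym (fromℤ-neg l)) (<-respʳ-≈ (-‿involutive x) (neg-anti -x<l))
    cancel : ∀ i j → ℤ.- i ℤ.+ (i ℤ.+ j) ≡ j
    cancel = solve-∀

  ⌊_⌋ : Carrier → ℤ
  ⌊ x ⌋ = proj₁ (floor x)

  ⌊⌋-isFloor : ∀ x → IsFloor x ⌊ x ⌋
  ⌊⌋-isFloor x = proj₂ (floor x)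

  ⟪_⟫ : Carrier → ℤ
  ⟪ r ⟫ = ⌊ r + (1# + 1#) ⁻¹ ⌋

  -- Coefficients are listed from the constant term upwards.
  evalPoly : List Carrier → Carrier → Carrier
  evalPoly cs x = foldr (λ c v → c + x * v) 0# cs

  -- `respects` only makes the family independent of the choice of
  -- representatives for the setoid equality _≈_ of the reals.
  data GeneralisedPolynomial : (ℤ → Carrier) → Set where
    polynomial : ∀ cs → GeneralisedPolynomial (λ n → evalPoly cs (fromℤ n))
    add        : ∀ {f g} → GeneralisedPolynomial f → GeneralisedPolynomial g →
                 GeneralisedPolynomial (λ n → f n + g n)
    mul        : ∀ {f g} → GeneralisedPolynomial f → GeneralisedPolynomial g →
                 GeneralisedPolynomial (λ n → f n * g n)
    integer    : ∀ {f} → GeneralisedPolynomial f →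
                 GeneralisedPolynomial (λ n → fromℤ ⌊ f n ⌋)
    respects   : ∀ {f g} → (∀ n → f n ≈ g n) → GeneralisedPolynomial f →
                 GeneralisedPolynomial g

  IsCharacteristicFunction : Pred ℤ 0ℓ → (ℤ → Carrier) → Set
  IsCharacteristicFunction E χ = ∀ n → (n ∈ E → χ n ≈ 1#) × (n ∉ E → χ n ≈ 0#)

  GeneralisedPolynomialSet : Pred ℤ 0ℓ → Set
  GeneralisedPolynomialSet E =
    ∃[ χ ] IsCharacteristicFunction E χ × GeneralisedPolynomial χ

  cubic : ℤ → ℤ → Carrier → Carrier
  cubic a b x = x ^ 3 - fromℤ a * x ^ 2 - fromℤ b * x - 1#

  IsUniqueRoot : (Carrier → Carrier) → Pred Carrier 0ℓ
  IsUniqueRoot p β = p β ≈ 0# × (∀ x → p x ≈ 0# → x ≈ β)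

{-# OPTIONS --safe #-}
module Submission where

-- Write x = u + vβ + wβ² for (u , v , w) ∈ ℤ³ and let σ be a complex embedding of ℤ[β]; as the
-- cubic has no further real root, σ is not real and |σ(β)|² = 1/β < 1.  If m is the trace of βⁿ, then
-- m - βⁿ is small, and hence the coordinates of βⁿ are the integers nearest to fixed real multiples
-- of m; this yields generalised polynomials X(m) ∈ ℤ[β] with X(⟪βⁿ⟫) = βⁿ for large n.  It remains to
-- recognise the powers of β among the X(m).  The condition that X(m) has norm 1 is the vanishing of
-- an integer-valued generalised polynomial, but β need not be a fundamental unit of ℤ[β].  The
-- other units are excluded by a congruence: let C = βᵏ > 5 and let x have norm 1 and be congruent
-- modulo β²ᵏ - 1 to a power of β.  Then x ≡ βʲ for some j with x/C < βʲ ≤ Cx, and if x ≠ βʲ then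
-- the norm of x - βʲ is at most 2C in absolute value, while it is a non-zero multiple of the
-- norm of β²ᵏ - 1, which is about C².

open import Defs
open import Data.Integer.Base as ℤ using (ℤ; +_; -[1+_]; 0ℤ; 1ℤ; -1ℤ)
open import Data.Product.Base using (∃; ∃-syntax; Σ-syntax; _×_; _,_; proj₁; proj₂)
open import Data.Sum.Base using (_⊎_; inj₁; inj₂)
open import Relation.Binary.PropositionalEquality as ≡ using (_≡_; _≢_)
import Algebra.Properties.Monoid.Mult.TCOptimised as Mult′
import Algebra.Properties.Ring as RingProperties
import Algebra.Properties.Semiring.Exp as Exp
import Algebra.Properties.Semiring.Mult as Mult
import Algebra.Solver.Ring as RingSolver
open import Algebra.Solver.Ring.AlmostCommutativeRing
  using (fromCommutativeRing; _-Raw-AlmostCommutative⟶_)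
open import Data.Empty using (⊥; ⊥-elim)
import Data.Integer.DivMod as ℤ-DivMod
import Data.Integer.Properties as ℤₚ
open import Data.Integer.Solver using (module +-*-Solver)
open import Data.Integer.Tactic.RingSolver using (solve-∀)
open import Data.List.Base using ([]; _∷_)
open import Data.Maybe.Base using (Maybe; just; nothing)
open import Data.Nat.Base as ℕ using (ℕ; zero; suc)
import Data.Nat.DivMod as ℕ-DivMod
import Data.Nat.Properties as ℕₚ
open import Level using (0ℓ)
open import Relation.Binary.Definitions using (tri<; tri≈; tri>)
import Relation.Binary.Construct.StrictToNonStrict as NonStrict
import Relation.Binary.Reasoning.Setoid as SetoidReasoning
open import Relation.Binary.Structures using (IsTotalOrder)
open import Relation.Nullary using (¬_; yes; no)
open import Relation.Unary using (Pred)

open +-*-Solver using () renaming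
  (solve to ℤ-solve; con to ℤ-con; _:+_ to _⊞_; _:*_ to _⊠_; _:-_ to _⊟_; :-_ to ⊟_; _:=_ to _⩵_)

-- A generalised polynomial in m cannot quantify over the exponent n, so membership must be
-- expressed by finitely many equations and congruences between integer-valued generalised
-- polynomials in m. Equations are tested with the help of an irrational number, and β itself
-- supplies one. The congruence is a finite condition because the ideal of βˡ - 1 contains Nℤ[β],
-- where N is the norm of βˡ - 1: only the coordinates modulo N matter. The exponent l = 2k explains
-- the gain of a square root. Powers of β in one class are spaced by the factor βˡ = C², so a large
-- x lies within a factor C of one of them; the norm of the difference is then of order C, against
-- C² for the modulus. Complex numbers never occur: σ is present only through the sum s and the
-- product p of the two complex roots and through the quadratic form |σ(x)|². Its triangle
-- inequality is replaced by the parallelogram law, which costs constant factors.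

i<suc[j]⇒i≤j : ∀ {i j} → i ℤ.< ℤ.suc j → i ℤ.≤ j
i<suc[j]⇒i≤j {i} {j} i<1+j = ≡.subst (i ℤ.≤_) (ℤₚ.pred-suc j) (ℤₚ.i<j⇒i≤pred[j] i<1+j)

-- Integer triples and congruences modulo an endomorphism

-- ⟨ u , v , w ⟩ stands for u + vβ + wβ².
record Triple : Set where
  no-eta-equality; pattern
  constructor ⟨_,_,_⟩
  field
    fst snd thd : ℤ

infix  4 _≋_[mod_]
infixl 6 _⊕_ _⊝_
infixr 7 _⊙_

_⊕_ _⊝_ : Triple → Triple → Triple
⟨ u , v , w ⟩ ⊕ ⟨ u′ , v′ , w′ ⟩ = ⟨ u ℤ.+ u′ , v ℤ.+ v′ , w ℤ.+ w′ ⟩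
⟨ u , v , w ⟩ ⊝ ⟨ u′ , v′ , w′ ⟩ = ⟨ u ℤ.- u′ , v ℤ.- v′ , w ℤ.- w′ ⟩

_⊙_ : ℤ → Triple → Triple
k ⊙ ⟨ u , v , w ⟩ = ⟨ k ℤ.* u , k ℤ.* v , k ℤ.* w ⟩

triple-≡ : ∀ {u u′ v v′ w w′} → u ≡ u′ → v ≡ v′ → w ≡ w′ → ⟨ u , v , w ⟩ ≡ ⟨ u′ , v′ , w′ ⟩
triple-≡ ≡.refl ≡.refl ≡.refl = ≡.refl

record IsLinear (T : Triple → Triple) : Set where
  field
    ⊕-homo : ∀ x y → T (x ⊕ y) ≡ T x ⊕ T y
    ⊙-homo : ∀ k x → T (k ⊙ x) ≡ k ⊙ T x

-- Congruence modulo the endomorphism T - 1.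
_≋_[mod_] : Triple → Triple → (Triple → Triple) → Set
x ≋ x′ [mod T ] = ∃[ y ] x ≡ x′ ⊕ (T y ⊝ y)

module Congruence {T : Triple → Triple} (lin : IsLinear T) where
  open IsLinear lin

  mod-refl : ∀ x → x ≋ x [mod T ]
  -- Zero is written as the multiple 0x because linearity is stated through `⊕` and `⊙` only;
  -- `mod-sym` negates in the same way.
  mod-refl x = 0ℤ ⊙ x , ≡.sym (≡.trans (≡.cong (λ z → x ⊕ (z ⊝ 0ℤ ⊙ x)) (⊙-homo 0ℤ x)) (zeros x (T x)))
    where
    zeros : ∀ x y → x ⊕ (0ℤ ⊙ y ⊝ 0ℤ ⊙ x) ≡ x
    zeros ⟨ u , v , w ⟩ ⟨ u′ , v′ , w′ ⟩ = triple-≡ (identity u u′) (identity v v′) (identity w w′)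
      where
      identity = ℤ-solve 2 (λ u u′ → u ⊞ (ℤ-con 0ℤ ⊠ u′ ⊟ ℤ-con 0ℤ ⊠ u) ⩵ u) ≡.refl

  mod-trans : ∀ {x x′ x″} → x ≋ x′ [mod T ] → x′ ≋ x″ [mod T ] → x ≋ x″ [mod T ]
  mod-trans {x″ = x″} (y , ≡.refl) (y′ , ≡.refl) =
    y′ ⊕ y , ≡.trans (regroup x″ y y′ (T y) (T y′)) (≡.cong (λ z → x″ ⊕ (z ⊝ (y′ ⊕ y))) (≡.sym (⊕-homo y′ y)))
    where
    regroup : ∀ x y y′ z z′ → x ⊕ (z′ ⊝ y′) ⊕ (z ⊝ y) ≡ x ⊕ ((z′ ⊕ z) ⊝ (y′ ⊕ y))
    regroup ⟨ a , b , c ⟩ ⟨ d , e , f ⟩ ⟨ g , h , i ⟩ ⟨ j , k , l ⟩ ⟨ m , n , o ⟩ =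
      triple-≡ (identity a d g j m) (identity b e h k n) (identity c f i l o)
      where
      identity = ℤ-solve 5 (λ a d g j m → a ⊞ (m ⊟ g) ⊞ (j ⊟ d) ⩵ a ⊞ (m ⊞ j ⊟ (g ⊞ d))) ≡.refl

  mod-sym : ∀ {x x′} → x ≋ x′ [mod T ] → x′ ≋ x [mod T ]
  mod-sym {x′ = x} (y , ≡.refl) =
    -1ℤ ⊙ y , ≡.trans (cancel x y (T y)) (≡.cong (λ z → x ⊕ (T y ⊝ y) ⊕ (z ⊝ -1ℤ ⊙ y)) (≡.sym (⊙-homo -1ℤ y)))
    where
    cancel : ∀ x y z → x ≡ x ⊕ (z ⊝ y) ⊕ (-1ℤ ⊙ z ⊝ -1ℤ ⊙ y)
    cancel ⟨ a , b , c ⟩ ⟨ d , e , f ⟩ ⟨ g , h , i ⟩ =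
      triple-≡ (identity a d g) (identity b e h) (identity c f i)
      where
      identity = ℤ-solve 3 (λ a d g → a ⩵ a ⊞ (g ⊟ d) ⊞ (ℤ-con -1ℤ ⊠ g ⊟ ℤ-con -1ℤ ⊠ d)) ≡.refl

  T-mod : ∀ x → T x ≋ x [mod T ]
  T-mod x = x , identity′ x (T x)
    where
    identity = ℤ-solve 2 (λ a b → b ⩵ a ⊞ (b ⊟ a)) ≡.refl
    identity′ : ∀ x y → y ≡ x ⊕ (y ⊝ x)
    identity′ ⟨ a , b , c ⟩ ⟨ d , e , f ⟩ = triple-≡ (identity a d) (identity b e) (identity c f)

  -- The norm t - s of T - 1 is divisible by T - 1: the quotient comes from
  -- X³ - tX² + sX - 1 = (X - 1)(X² + (1 - t)X + (1 - t + s)) - (t - s).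
  norm-mod : ∀ {t s} → (∀ x → T (T (T x)) ≡ t ⊙ T (T x) ⊝ s ⊙ T x ⊕ x) →
             ∀ x z → x ⊕ (t ℤ.- s) ⊙ z ≋ x [mod T ]
  norm-mod {t} {s} relation x z = y , ≡.cong (x ⊕_)
    (≡.trans (identity′ (T (T z)) (T z) z) (≡.cong (_⊝ y) (≡.sym Ty)))
    where
    y = T (T z) ⊕ (1ℤ ℤ.- t) ⊙ T z ⊕ (1ℤ ℤ.- t ℤ.+ s) ⊙ z
    Ty : T y ≡ (t ⊙ T (T z) ⊝ s ⊙ T z ⊕ z) ⊕ (1ℤ ℤ.- t) ⊙ T (T z) ⊕ (1ℤ ℤ.- t ℤ.+ s) ⊙ T z
    Ty = ≡.trans (⊕-homo (T (T z) ⊕ (1ℤ ℤ.- t) ⊙ T z) ((1ℤ ℤ.- t ℤ.+ s) ⊙ z)) (≡.cong₂ _⊕_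
      (≡.trans (⊕-homo (T (T z)) ((1ℤ ℤ.- t) ⊙ T z)) (≡.cong₂ _⊕_ (relation z) (⊙-homo (1ℤ ℤ.- t) (T z))))
      (⊙-homo (1ℤ ℤ.- t ℤ.+ s) z))
    identity′ : ∀ z″ z′ z → (t ℤ.- s) ⊙ z ≡
      (t ⊙ z″ ⊝ s ⊙ z′ ⊕ z) ⊕ (1ℤ ℤ.- t) ⊙ z″ ⊕ (1ℤ ℤ.- t ℤ.+ s) ⊙ z′ ⊝ (z″ ⊕ (1ℤ ℤ.- t) ⊙ z′ ⊕ (1ℤ ℤ.- t ℤ.+ s) ⊙ z)
    identity′ ⟨ a , b , c ⟩ ⟨ d , e , f ⟩ ⟨ g , h , i ⟩ =
      triple-≡ (identity t s a d g) (identity t s b e h) (identity t s c f i)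
      where
      identity = ℤ-solve 5 (λ t s z″ z′ z →
        let c = ℤ-con 1ℤ ⊟ t
            d = ℤ-con 1ℤ ⊟ t ⊞ s in
        (t ⊟ s) ⊠ z ⩵ (t ⊠ z″ ⊟ s ⊠ z′ ⊞ z) ⊞ c ⊠ z″ ⊞ d ⊠ z′ ⊟ (z″ ⊞ c ⊠ z′ ⊞ d ⊠ z)) ≡.refl

-- Graeffe's root squaring: if T is a root of X³ - tX² + sX - 1, then T² is a root of
-- X³ - (t² - 2s)X² + (s² - 2t)X - 1.
squared-relation : ∀ {T : Triple → Triple} {t s} → (∀ x → T (T (T x)) ≡ t ⊙ T (T x) ⊝ s ⊙ T x ⊕ x) →
  ∀ x → T (T (T (T (T (T x)))))
    ≡ (t ℤ.* t ℤ.- + 2 ℤ.* s) ⊙ T (T (T (T x))) ⊝ (s ℤ.* s ℤ.- + 2 ℤ.* t) ⊙ T (T x) ⊕ x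
squared-relation {T} {t} {s} relation x =
  combine x (T x) (T (T x)) (relation x) (relation (T x)) (relation (T (T x))) (relation (T (T (T x))))
  where
  combine : ∀ x₀ x₁ x₂ {x₃ x₄ x₅ x₆} → x₃ ≡ t ⊙ x₂ ⊝ s ⊙ x₁ ⊕ x₀ → x₄ ≡ t ⊙ x₃ ⊝ s ⊙ x₂ ⊕ x₁ →
            x₅ ≡ t ⊙ x₄ ⊝ s ⊙ x₃ ⊕ x₂ → x₆ ≡ t ⊙ x₅ ⊝ s ⊙ x₄ ⊕ x₃ →
            x₆ ≡ (t ℤ.* t ℤ.- + 2 ℤ.* s) ⊙ x₄ ⊝ (s ℤ.* s ℤ.- + 2 ℤ.* t) ⊙ x₂ ⊕ x₀
  combine ⟨ a , b , c ⟩ ⟨ d , e , f ⟩ ⟨ g , h , i ⟩ ≡.refl ≡.refl ≡.refl ≡.refl =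
    triple-≡ (identity t s a d g) (identity t s b e h) (identity t s c f i)
    where
    identity = ℤ-solve 5 (λ t s x₀ x₁ x₂ →
      let x₃ = t ⊠ x₂ ⊟ s ⊠ x₁ ⊞ x₀
          x₄ = t ⊠ x₃ ⊟ s ⊠ x₂ ⊞ x₁
          x₅ = t ⊠ x₄ ⊟ s ⊠ x₃ ⊞ x₂ in
      t ⊠ x₅ ⊟ s ⊠ x₄ ⊞ x₃ ⩵
        (t ⊠ t ⊟ ℤ-con (+ 2) ⊠ s) ⊠ x₄ ⊟ (s ⊠ s ⊟ ℤ-con (+ 2) ⊠ t) ⊠ x₂ ⊞ x₀) ≡.refl

module NearestPowers (ℝ : CompleteOrderedField) where

  open Real ℝ
  open SetoidReasoning setoid
  open Exp semiring using (^-homo-*)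

  open RingProperties ring using (-‿involutive; -‿distribˡ-*; -‿distribʳ-*; -0#≈0#; -‿+-comm)
  private
    module M = Mult semiring
    module M′ = Mult′ +-monoid
    module N = NonStrict _≈_ _<_

  -- The embedding of the integers and the ring solver

  fromℤ-⊖ : ∀ m n → fromℤ (m ℤ.⊖ n) ≈ fromℤ (+ m) - fromℤ (+ n)
  fromℤ-⊖ m       zero    = sym (trans (+-congˡ -0#≈0#) (+-identityʳ _))
  fromℤ-⊖ zero    (suc n) = sym (+-identityˡ _)
  fromℤ-⊖ (suc m) (suc n) = begin
    fromℤ (suc m ℤ.⊖ suc n)                        ≡⟨ ≡.cong fromℤ (ℤₚ.[1+m]⊖[1+n]≡m⊖n m n) ⟩
    fromℤ (m ℤ.⊖ n)                                ≈⟨ fromℤ-⊖ m n ⟩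
    fromℤ (+ m) - fromℤ (+ n)                      ≈⟨ +-congˡ (+-identityˡ _) ⟨
    fromℤ (+ m) + (0# - fromℤ (+ n))               ≈⟨ +-congˡ (+-congʳ (-‿inverseʳ 1#)) ⟨
    fromℤ (+ m) + ((1# - 1#) - fromℤ (+ n))        ≈⟨ +-congˡ (+-assoc _ _ _) ⟩
    fromℤ (+ m) + (1# + (- 1# - fromℤ (+ n)))      ≈⟨ +-assoc _ _ _ ⟨
    (fromℤ (+ m) + 1#) + (- 1# - fromℤ (+ n))      ≈⟨ +-cong (+-comm _ _) (-‿+-comm _ _) ⟩
    (1# + fromℤ (+ m)) - (1# + fromℤ (+ n))        ∎

  fromℤ-neg : ∀ i → fromℤ (ℤ.- i) ≈ - fromℤ i
  fromℤ-neg (+ zero)  = sym -0#≈0#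
  fromℤ-neg (+ suc n) = refl
  fromℤ-neg -[1+ n ]  = sym (-‿involutive _)

  fromℤ-+ : ∀ i j → fromℤ (i ℤ.+ j) ≈ fromℤ i + fromℤ j
  fromℤ-+ (+ m)    (+ n)    = M.×-homo-+ 1# m n
  fromℤ-+ (+ m)    -[1+ n ] = fromℤ-⊖ m (suc n)
  fromℤ-+ -[1+ m ] (+ n)    = trans (fromℤ-⊖ n (suc m)) (+-comm _ _)
  fromℤ-+ -[1+ m ] -[1+ n ] = trans (-‿cong
    (trans (reflexive (≡.cong (λ k → fromℤ (+ suc k)) (≡.sym (ℕₚ.+-suc m n))))
              (M.×-homo-+ 1# (suc m) (suc n))))
                                    (sym (-‿+-comm _ _))

  fromℤ-* : ∀ i j → fromℤ (i ℤ.* j) ≈ fromℤ i * fromℤ j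
  fromℤ-* i j = helper i j
    where
    nonNeg : ∀ m j → fromℤ (+ m ℤ.* j) ≈ fromℤ (+ m) * fromℤ j
    nonNeg m (+ n) =
      trans (reflexive (≡.cong fromℤ (≡.sym (ℤₚ.pos-* m n)))) (M.×1-homo-* m n)
    nonNeg m -[1+ n ] = begin
      fromℤ (+ m ℤ.* -[1+ n ])          ≡⟨ ≡.cong fromℤ (ℤₚ.neg-distribʳ-* (+ m) (+ suc n)) ⟨
      fromℤ (ℤ.- (+ m ℤ.* + suc n))     ≈⟨ fromℤ-neg (+ m ℤ.* + suc n) ⟩
      - fromℤ (+ m ℤ.* + suc n)         ≈⟨ -‿cong (nonNeg m (+ suc n)) ⟩
      - (fromℤ (+ m) * fromℤ (+ suc n)) ≈⟨ -‿distribʳ-* _ _ ⟩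
      fromℤ (+ m) * fromℤ -[1+ n ]      ∎
    helper : ∀ i j → fromℤ (i ℤ.* j) ≈ fromℤ i * fromℤ j
    helper (+ m)    j = nonNeg m j
    helper -[1+ m ] j = begin
      fromℤ (-[1+ m ] ℤ.* j)            ≡⟨ ≡.cong fromℤ (ℤₚ.neg-distribˡ-* (+ suc m) j) ⟨
      fromℤ (ℤ.- (+ suc m ℤ.* j))       ≈⟨ fromℤ-neg (+ suc m ℤ.* j) ⟩
      - fromℤ (+ suc m ℤ.* j)           ≈⟨ -‿cong (nonNeg (suc m) j) ⟩
      - (fromℤ (+ suc m) * fromℤ j)     ≈⟨ -‿distribˡ-* _ _ ⟩
      fromℤ -[1+ m ] * fromℤ j          ∎

  fromℤ-1 : fromℤ 1ℤ ≈ 1#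
  fromℤ-1 = +-identityʳ 1#

  -- With the optimised multiple, `fromℕ 0`, `fromℕ 1` and `fromℕ 2` compute to `0#`, `1#` and
  -- `1# + 1#`, whereas `fromℤ 1ℤ` is `1# + 0#`. Constants of the solver thus denote exactly the
  -- constants that occur in the goals.
  fromℕ : ℕ → Carrier
  fromℕ n = n M′.× 1#

  fromℕ≈ : ∀ n → fromℤ (+ n) ≈ fromℕ n
  fromℕ≈ n = M′.×ᵤ≈× n 1#

  private
    coefficient : ℤ → Carrier
    coefficient (+ n)    = fromℕ n
    coefficient -[1+ n ] = - fromℕ (suc n)

    coefficient≈ : ∀ i → fromℤ i ≈ coefficient i
    coefficient≈ (+ n)    = fromℕ≈ n
    coefficient≈ -[1+ n ] = -‿cong (fromℕ≈ (suc n))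

    morphism : ℤ.+-*-rawRing -Raw-AlmostCommutative⟶ fromCommutativeRing commutativeRing
    morphism = record
      { ⟦_⟧    = coefficient
      ; +-homo = λ i j → trans (sym (coefficient≈ (i ℤ.+ j)))
        (trans (fromℤ-+ i j) (+-cong (coefficient≈ i) (coefficient≈ j)))
      ; *-homo = λ i j → trans (sym (coefficient≈ (i ℤ.* j)))
        (trans (fromℤ-* i j) (*-cong (coefficient≈ i) (coefficient≈ j)))
      ; -‿homo = λ i → trans (sym (coefficient≈ (ℤ.- i))) (trans (fromℤ-neg i) (-‿cong (coefficient≈ i)))
      ; 0-homo = refl
      ; 1-homo = refl
      }

    _≟_ : ∀ i j → Maybe (coefficient i ≈ coefficient j)
    i ≟ j with i ℤₚ.≟ j
    ... | yes i≡j = just (reflexive (≡.cong coefficient i≡j))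
    ... | no  _   = nothing

  open RingSolver ℤ.+-*-rawRing (fromCommutativeRing commutativeRing) morphism _≟_ public
    using (Polynomial; solve; _:=_; _:+_; _:*_; _:-_; :-_; con)

  -- Arithmetic of the ordered field

  private module ≤ = IsTotalOrder (N.isTotalOrder isStrictTotalOrder)

  ≤-refl : ∀ {x} → x ≤ x
  ≤-refl = inj₂ refl

  ≤-trans : ∀ {x y z} → x ≤ y → y ≤ z → x ≤ z
  ≤-trans = ≤.trans

  ≤-respˡ-≈ : ∀ {x y z} → x ≈ y → x ≤ z → y ≤ z
  ≤-respˡ-≈ = ≤.≲-respˡ-≈

  ≤-respʳ-≈ : ∀ {x y z} → x ≈ y → z ≤ x → z ≤ y
  ≤-respʳ-≈ = ≤.≲-respʳ-≈

  <-≤-trans : ∀ {x y z} → x < y → y ≤ z → x < z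
  <-≤-trans = N.<-≤-trans <-trans <-respʳ-≈

  ≤-<-trans : ∀ {x y z} → x ≤ y → y < z → x < z
  ≤-<-trans = N.≤-<-trans sym <-trans <-respˡ-≈

  <-irr : ∀ {x} → ¬ x < x
  <-irr = irrefl refl

  ≤⇒≯ : ∀ {x y} → x ≤ y → ¬ y < x
  ≤⇒≯ x≤y y<x = <-irr (≤-<-trans x≤y y<x)

  ≮⇒≥ : ∀ {x y} → ¬ x < y → y ≤ x
  ≮⇒≥ {x} {y} x≮y with compare x y
  ... | tri< x<y _ _ = ⊥-elim (x≮y x<y)
  ... | tri≈ _ x≈y _ = inj₂ (sym x≈y)
  ... | tri> _ _ y<x = inj₁ y<x

  <⊎≥ : ∀ x y → x < y ⊎ y ≤ x
  <⊎≥ x y with compare x y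
  ... | tri< x<y _ _ = inj₁ x<y
  ... | tri≈ _ x≈y _ = inj₂ (inj₂ (sym x≈y))
  ... | tri> _ _ y<x = inj₂ (inj₁ y<x)

  +-monoˡ-≤ : ∀ {x y} z → x ≤ y → x + z ≤ y + z
  +-monoˡ-≤ z (inj₁ x<y) = inj₁ (+-monoˡ-< z x<y)
  +-monoˡ-≤ z (inj₂ x≈y) = inj₂ (+-congʳ x≈y)

  private
    +-minus : ∀ {x y d} → d ≈ y - x → d + x ≈ y
    +-minus {x} {y} d≈ = trans (+-congʳ d≈) (solve 2 (λ x y → y :- x :+ x := y) refl x y)

  <-fromDifference : ∀ {x y d} → d ≈ y - x → 0# < d → x < y
  <-fromDifference {x} d≈ 0<d = <-respˡ-≈ (+-identityˡ x) (<-respʳ-≈ (+-minus d≈) (+-monoˡ-< x 0<d))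

  ≤-fromDifference : ∀ {x y d} → d ≈ y - x → 0# ≤ d → x ≤ y
  ≤-fromDifference {x} d≈ 0≤d = ≤-respˡ-≈ (+-identityˡ x) (≤-respʳ-≈ (+-minus d≈) (+-monoˡ-≤ x 0≤d))

  <⇒0<difference : ∀ {x y} → x < y → 0# < y - x
  <⇒0<difference {x} x<y = <-respˡ-≈ (-‿inverseʳ x) (+-monoˡ-< (- x) x<y)

  ≤⇒0≤difference : ∀ {x y} → x ≤ y → 0# ≤ y - x
  ≤⇒0≤difference {x} x≤y = ≤-respˡ-≈ (-‿inverseʳ x) (+-monoˡ-≤ (- x) x≤y)

  0≤-+ : ∀ {x y} → 0# ≤ x → 0# ≤ y → 0# ≤ x + y
  0≤-+ {x} {y} 0≤x 0≤y = ≤-trans 0≤y (≤-respˡ-≈ (+-identityˡ y) (+-monoˡ-≤ y 0≤x))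

  0<-+ : ∀ {x y} → 0# < x → 0# ≤ y → 0# < x + y
  0<-+ {x} {y} 0<x 0≤y = ≤-<-trans 0≤y (<-respˡ-≈ (+-identityˡ y) (+-monoˡ-< y 0<x))

  0≤-* : ∀ {x y} → 0# ≤ x → 0# ≤ y → 0# ≤ x * y
  0≤-* (inj₁ 0<x) (inj₁ 0<y) = inj₁ (*-pos 0<x 0<y)
  0≤-* {y = y} (inj₂ 0≈x) _  = inj₂ (trans (sym (zeroˡ y)) (*-congʳ 0≈x))
  0≤-* {x} _ (inj₂ 0≈y)      = inj₂ (trans (sym (zeroʳ x)) (*-congˡ 0≈y))

  0<⇒≉0 : ∀ {x} → 0# < x → ¬ x ≈ 0#
  0<⇒≉0 0<x x≈0 = irrefl (sym x≈0) 0<x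

  <0⇒0<- : ∀ {x} → x < 0# → 0# < - x
  <0⇒0<- x<0 = <-respʳ-≈ (+-identityˡ _) (<⇒0<difference x<0)

  0<-square : ∀ {x} → ¬ x ≈ 0# → 0# < x * x
  0<-square {x} x≉0 with compare 0# x
  ... | tri< 0<x _ _ = *-pos 0<x 0<x
  ... | tri≈ _ 0≈x _ = ⊥-elim (x≉0 (sym 0≈x))
  ... | tri> _ _ x<0 = <-respʳ-≈ (solve 1 (λ x → (:- x) :* (:- x) := x :* x) refl x)
                         (*-pos (<0⇒0<- x<0) (<0⇒0<- x<0))

  0≤-square : ∀ x → 0# ≤ x * x
  0≤-square x with compare 0# x
  ... | tri≈ _ 0≈x _  = 0≤-* (inj₂ 0≈x) (inj₂ 0≈x)
  ... | tri< _ 0≉x _  = inj₁ (0<-square (λ x≈0 → 0≉x (sym x≈0)))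
  ... | tri> _ 0≉x _  = inj₁ (0<-square (λ x≈0 → 0≉x (sym x≈0)))

  0<1 : 0# < 1#
  0<1 = <-respʳ-≈ (*-identityˡ 1#) (0<-square (λ 1≈0 → 0≉1 (sym 1≈0)))

  *-monoˡ-< : ∀ {c x y} → 0# < c → x < y → c * x < c * y
  *-monoˡ-< {c} {x} {y} 0<c x<y =
    <-fromDifference (solve 3 (λ c x y → c :* (y :- x) := c :* y :- c :* x) refl c x y)
      (*-pos 0<c (<⇒0<difference x<y))

  *-monoˡ-≤ : ∀ {c x y} → 0# ≤ c → x ≤ y → c * x ≤ c * y
  *-monoˡ-≤ {c} {x} {y} 0≤c x≤y =
    ≤-fromDifference (solve 3 (λ c x y → c :* (y :- x) := c :* y :- c :* x) refl c x y)
      (0≤-* 0≤c (≤⇒0≤difference x≤y))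

  *-cancelˡ-< : ∀ {c x y} → 0# < c → c * x < c * y → x < y
  *-cancelˡ-< {c} {x} {y} 0<c cx<cy with <⊎≥ x y
  ... | inj₁ x<y = x<y
  ... | inj₂ y≤x = ⊥-elim (≤⇒≯ (*-monoˡ-≤ (inj₁ 0<c) y≤x) cx<cy)

  *-cancelˡ-≈ : ∀ {c x y} → ¬ c ≈ 0# → c * x ≈ c * y → x ≈ y
  *-cancelˡ-≈ {c} {x} {y} c≉0 cx≈cy = begin
    x                ≈⟨ *-identityˡ x ⟨
    1# * x           ≈⟨ *-congʳ (*-inverseʳ c c≉0) ⟨
    c * c ⁻¹ * x     ≈⟨ solve 3 (λ c d x → c :* d :* x := d :* (c :* x)) refl c (c ⁻¹) x ⟩
    c ⁻¹ * (c * x)   ≈⟨ *-congˡ cx≈cy ⟩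
    c ⁻¹ * (c * y)   ≈⟨ solve 3 (λ c d x → c :* d :* x := d :* (c :* x)) refl c (c ⁻¹) y ⟨
    c * c ⁻¹ * y     ≈⟨ *-congʳ (*-inverseʳ c c≉0) ⟩
    1# * y           ≈⟨ *-identityˡ y ⟩
    y                ∎

  x*k⁻¹*k≈x : ∀ x {k} → 0# < k → x * k ⁻¹ * k ≈ x
  x*k⁻¹*k≈x x {k} 0<k = trans (*-assoc x _ _)
    (trans (*-congˡ (trans (*-comm _ _) (*-inverseʳ k (0<⇒≉0 0<k)))) (*-identityʳ x))

  0<-⁻¹ : ∀ {x} → 0# < x → 0# < x ⁻¹
  0<-⁻¹ {x} 0<x = *-cancelˡ-< 0<x
    (<-respˡ-≈ (sym (zeroʳ x)) (<-respʳ-≈ (sym (*-inverseʳ x (0<⇒≉0 0<x))) 0<1))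

  0≤-fromℤ : ∀ n → 0# ≤ fromℤ (+ n)
  0≤-fromℤ zero    = ≤-refl
  0≤-fromℤ (suc n) = inj₁ (0<-+ 0<1 (0≤-fromℤ n))

  0≤-fromℕ : ∀ n → 0# ≤ fromℕ n
  0≤-fromℕ n = ≤-respʳ-≈ (fromℕ≈ n) (0≤-fromℤ n)

  0<-fromℕ : ∀ n → 0# < fromℕ (suc n)
  0<-fromℕ n = <-respʳ-≈ (fromℕ≈ (suc n)) (0<-+ 0<1 (0≤-fromℤ n))

  fromℤ-difference : ∀ i j → fromℤ (j ℤ.- i) ≈ fromℤ j - fromℤ i
  fromℤ-difference i j = trans (fromℤ-+ j (ℤ.- i)) (+-congˡ (fromℤ-neg i))

  fromℤ-mono-≤ : ∀ {i j} → i ℤ.≤ j → fromℤ i ≤ fromℤ j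
  fromℤ-mono-≤ {i} {j} i≤j =
    ≤-fromDifference (fromℤ-difference i j) (0≤-nonNeg (ℤₚ.i≤j⇒0≤j-i i≤j))
    where
    0≤-nonNeg : ∀ {k} → 0ℤ ℤ.≤ k → 0# ≤ fromℤ k
    0≤-nonNeg {+ n} _ = 0≤-fromℤ n

  fromℤ-mono-< : ∀ {i j} → i ℤ.< j → fromℤ i < fromℤ j
  fromℤ-mono-< {i} {j} i<j = <-≤-trans
    (<-fromDifference (solve 2 (λ o x → o := (o :+ x) :- x) refl (fromℤ 1ℤ) (fromℤ i))
       (<-respʳ-≈ (sym fromℤ-1) 0<1))
    (≤-respˡ-≈ (fromℤ-+ 1ℤ i) (fromℤ-mono-≤ (ℤₚ.i<j⇒suc[i]≤j i<j)))

  fromℤ-cancel-< : ∀ {i j} → fromℤ i < fromℤ j → i ℤ.< j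
  fromℤ-cancel-< {i} {j} i<j with i ℤₚ.<? j
  ... | yes p = p
  ... | no  p = ⊥-elim (≤⇒≯ (fromℤ-mono-≤ (ℤₚ.≮⇒≥ p)) i<j)

  fromℤ-injective : ∀ {i j} → fromℤ i ≈ fromℤ j → i ≡ j
  fromℤ-injective {i} {j} i≈j with ℤₚ.<-cmp i j
  ... | tri< p _ _ = ⊥-elim (irrefl i≈j (fromℤ-mono-< p))
  ... | tri≈ _ p _ = p
  ... | tri> _ _ p = ⊥-elim (irrefl (sym i≈j) (fromℤ-mono-< p))

  -- Integer parts and nearest integers

  IsFloor-unique : ∀ {x y} i j → x ≈ y → IsFloor x i → IsFloor y j → i ≡ j
  IsFloor-unique i j x≈y (i≤x , x<1+i) (j≤y , y<1+j) = ℤₚ.≤-antisym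
    (i<suc[j]⇒i≤j (fromℤ-cancel-< (≤-<-trans i≤x (<-respˡ-≈ (sym x≈y) y<1+j))))
    (i<suc[j]⇒i≤j (fromℤ-cancel-< (≤-<-trans j≤y (<-respˡ-≈ x≈y x<1+i))))

  IsFloor-fromℤ : ∀ i → IsFloor (fromℤ i) i
  IsFloor-fromℤ i = ≤-refl , fromℤ-mono-< {i} (ℤₚ.suc[i]≤j⇒i<j ℤₚ.≤-refl)

  ½ : Carrier
  ½ = (1# + 1#) ⁻¹

  ½+½≈1 : ½ + ½ ≈ 1#
  ½+½≈1 = trans (trans (sym (+-cong (*-identityˡ ½) (*-identityˡ ½))) (sym (distribʳ ½ 1# 1#)))
            (*-inverseʳ (1# + 1#) (0<⇒≉0 (0<-+ 0<1 (inj₁ 0<1))))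

  -- Stated with (1# + 1#) ⁻¹ in place of ½ so that the type checker does not have to unfold ⌊_⌋.
  ⟪⟫-isFloor : ∀ r → IsFloor (r + (1# + 1#) ⁻¹) ⟪ r ⟫
  ⟪⟫-isFloor r = ⌊⌋-isFloor (r + (1# + 1#) ⁻¹)

  IsFloor⇒≡⟪⟫ : ∀ r m → IsFloor (r + ½) m → m ≡ ⟪ r ⟫
  IsFloor⇒≡⟪⟫ r m m-floor = IsFloor-unique m ⟪ r ⟫ refl m-floor (⟪⟫-isFloor r)

  ≡⟪⟫⇒IsFloor : ∀ r m → m ≡ ⟪ r ⟫ → IsFloor (r + ½) m
  ≡⟪⟫⇒IsFloor r m m≡⟪r⟫ = ≡.subst (IsFloor (r + ½)) (≡.sym m≡⟪r⟫) (⟪⟫-isFloor r)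

  IsFloor-+½ : ∀ {x} i → - ½ < x - fromℤ i → x - fromℤ i < ½ → IsFloor (x + ½) i
  IsFloor-+½ {x} i lower upper =
    inj₁ (<-fromDifference (solve 3 (λ x i h → x :- i :- :- h := x :+ h :- i) refl x (fromℤ i) ½)
      (<⇒0<difference lower)) ,
    <-respʳ-≈ (sym (fromℤ-+ 1ℤ i))
      (<-fromDifference
        (begin
          ½ - (x - fromℤ i)
            ≈⟨ solve 3 (λ x i h → h :- (x :- i) := (h :+ h) :+ i :- (x :+ h)) refl x (fromℤ i) ½ ⟩
          (½ + ½) + fromℤ i - (x + ½)      ≈⟨ +-congʳ (+-congʳ (trans ½+½≈1 (sym fromℤ-1))) ⟩
          fromℤ 1ℤ + fromℤ i - (x + ½)     ∎)
        (<⇒0<difference upper))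

  -- Downward search from `n`. It will place a number between consecutive terms of the progression
  -- βⁱ, βⁱ⁺ˡ, βⁱ⁺²ˡ, and so on.
  bracket : ∀ (f : ℕ → Carrier) {x} → f 0 ≤ x → ∀ n → x < f n → ∃[ m ] f m ≤ x × x < f (suc m)
  bracket f     f0≤x zero    x<f0 = ⊥-elim (≤⇒≯ f0≤x x<f0)
  bracket f {x} f0≤x (suc n) x<f  with <⊎≥ x (f n)
  ... | inj₁ x<fn = bracket f f0≤x n x<fn
  ... | inj₂ fn≤x = n , fn≤x , x<f

  -- Closure properties of generalised polynomials and their sets

  constant : ∀ c → GeneralisedPolynomial (λ _ → c)
  constant c = respects (λ n → trans (+-congˡ (zeroʳ _)) (+-identityʳ c)) (polynomial (c ∷ []))

  argument : GeneralisedPolynomial fromℤ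
  argument = respects
    (λ n → trans (+-identityˡ _) (trans (*-congˡ (trans (+-congˡ (zeroʳ _)) (+-identityʳ 1#)))
      (*-identityʳ _)))
    (polynomial (0# ∷ 1# ∷ []))

  scale : ∀ {f} c → GeneralisedPolynomial f → GeneralisedPolynomial (λ n → c * f n)
  scale c F = mul (constant c) F

  subtract : ∀ {f g} → GeneralisedPolynomial f → GeneralisedPolynomial g →
             GeneralisedPolynomial (λ n → f n - g n)
  subtract {f} {g} F G = respects
    (λ n → solve 2 (λ x y → x :+ con -1ℤ :* y := x :- y) refl (f n) (g n))
    (add F (scale (- 1#) G))

  -- Hiding ⌊_⌋ behind a variable keeps the type checker from unfolding it.
  IntegerPart : (ℤ → Carrier) → Set
  IntegerPart f = Σ[ q ∈ (ℤ → ℤ) ] (∀ n → IsFloor (f n) (q n)) × GeneralisedPolynomial (λ n → fromℤ (q n))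

  integerPart : ∀ {f} → GeneralisedPolynomial f → IntegerPart f
  integerPart {f} F = (λ n → ⌊ f n ⌋) , (λ n → ⌊⌋-isFloor (f n)) , integer F

  set-⇔ : ∀ {E F : Pred ℤ 0ℓ} → (∀ n → E n → F n) → (∀ n → F n → E n) →
          GeneralisedPolynomialSet E → GeneralisedPolynomialSet F
  set-⇔ to from (χ , isχ , X) =
    χ , (λ n → (λ n∈F → proj₁ (isχ n) (from n n∈F)) , (λ n∉F → proj₂ (isχ n) (λ n∈E → n∉F (to n n∈E)))) , X

  -- Excluded middle chooses between the constants 1 and 0. In this way finite case distinctions may
  -- involve conditions without a decision procedure, such as the class of a fixed triple.
  set-constant : (P : Set) → GeneralisedPolynomialSet (λ _ → P)
  set-constant P with excludedMiddle P
  ... | yes p = (λ _ → 1#) , (λ _ → (λ _ → refl) , (λ ¬p → ⊥-elim (¬p p))) , constant 1#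
  ... | no ¬p = (λ _ → 0#) , (λ _ → (λ p → ⊥-elim (¬p p)) , (λ _ → refl)) , constant 0#

  set-∩ : ∀ {E F : Pred ℤ 0ℓ} → GeneralisedPolynomialSet E → GeneralisedPolynomialSet F →
          GeneralisedPolynomialSet (λ n → E n × F n)
  set-∩ {E} {F} (χ , isχ , X) (ψ , isψ , Y) = (λ n → χ n * ψ n) , is , mul X Y
    where
    is : IsCharacteristicFunction (λ n → E n × F n) (λ n → χ n * ψ n)
    proj₁ (is n) (n∈E , n∈F) = trans (*-cong (proj₁ (isχ n) n∈E) (proj₁ (isψ n) n∈F)) (*-identityˡ 1#)
    proj₂ (is n) n∉ with excludedMiddle (E n)
    ... | yes n∈E = trans (*-congˡ (proj₂ (isψ n) (λ n∈F → n∉ (n∈E , n∈F)))) (zeroʳ _)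
    ... | no  n∉E = trans (*-congʳ (proj₂ (isχ n) n∉E)) (zeroˡ _)

  set-∁ : ∀ {E : Pred ℤ 0ℓ} → GeneralisedPolynomialSet E → GeneralisedPolynomialSet (λ n → ¬ E n)
  set-∁ {E} (χ , isχ , X) = (λ n → 1# - χ n) , is , subtract (constant 1#) X
    where
    is : IsCharacteristicFunction (λ n → ¬ E n) (λ n → 1# - χ n)
    proj₁ (is n) n∉E = trans (+-congˡ (-‿cong (proj₂ (isχ n) n∉E))) (solve 1 (λ x → x :- con 0ℤ := x) refl 1#)
    proj₂ (is n) ¬n∉E with excludedMiddle (E n)
    ... | yes n∈E = trans (+-congˡ (-‿cong (proj₁ (isχ n) n∈E))) (-‿inverseʳ 1#)
    ... | no  n∉E = ⊥-elim (¬n∉E n∉E)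

  set-∪ : ∀ {E F : Pred ℤ 0ℓ} → GeneralisedPolynomialSet E → GeneralisedPolynomialSet F →
          GeneralisedPolynomialSet (λ n → E n ⊎ F n)
  set-∪ {E} {F} X Y = set-⇔ to from (set-∁ (set-∩ (set-∁ X) (set-∁ Y)))
    where
    to : ∀ n → ¬ (¬ E n × ¬ F n) → E n ⊎ F n
    to n h with excludedMiddle (E n) | excludedMiddle (F n)
    ... | yes p | _     = inj₁ p
    ... | no _  | yes q = inj₂ q
    ... | no ¬p | no ¬q = ⊥-elim (h (¬p , ¬q))
    from : ∀ n → E n ⊎ F n → ¬ (¬ E n × ¬ F n)
    from n (inj₁ p) (¬p , _) = ¬p p
    from n (inj₂ q) (_ , ¬q) = ¬q q

  set-⋃ : ∀ {E : ℕ → Pred ℤ 0ℓ} → (∀ r → GeneralisedPolynomialSet (E r)) → ∀ K →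
          GeneralisedPolynomialSet (λ n → ∃[ r ] r ℕ.< K × E r n)
  set-⋃ X zero = set-⇔ (λ _ ()) (λ _ ()) (set-constant ⊥)
  set-⋃ {E} X (suc K) = set-⇔ to from (set-∪ (set-⋃ X K) (X K))
    where
    to : ∀ n → (∃[ r ] r ℕ.< K × E r n) ⊎ E K n → ∃[ r ] r ℕ.< suc K × E r n
    to n (inj₁ (r , r<K , p)) = r , ℕₚ.m<n⇒m<1+n r<K , p
    to n (inj₂ p)             = K , ℕₚ.n<1+n K , p
    from : ∀ n → ∃[ r ] r ℕ.< suc K × E r n → (∃[ r ] r ℕ.< K × E r n) ⊎ E K n
    from n (r , r<1+K , p) with ℕₚ.m<1+n⇒m<n∨m≡n r<1+K
    ... | inj₁ r<K    = inj₁ (r , r<K , p)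
    ... | inj₂ ≡.refl = inj₂ p

  -- Zero sets and congruence conditions

  IsFloor-neg : ∀ {x} i → (∀ j → ¬ x ≈ fromℤ j) → IsFloor x i → IsFloor (- x) (ℤ.- ℤ.suc i)
  IsFloor-neg {x} i x∉ℤ (i≤x , x<1+i) = inj₁ lower , <-respʳ-≈ (reflexive (≡.cong fromℤ (identity i))) upper
    where
    lower : fromℤ (ℤ.- ℤ.suc i) < - x
    lower = <-respˡ-≈ (sym (fromℤ-neg (ℤ.suc i)))
      (<-fromDifference (solve 2 (λ x y → y :- x := :- x :- :- y) refl x _) (<⇒0<difference x<1+i))
    strict : fromℤ i ≤ x → fromℤ i < x
    strict (inj₁ i<x) = i<x
    strict (inj₂ i≈x) = ⊥-elim (x∉ℤ i (sym i≈x))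
    upper : - x < fromℤ (ℤ.- i)
    upper = <-respʳ-≈ (sym (fromℤ-neg i))
      (<-fromDifference (solve 2 (λ x y → x :- y := :- y :- :- x) refl x _) (<⇒0<difference (strict i≤x)))
    identity : ∀ i → ℤ.- i ≡ + 1 ℤ.+ ℤ.- (+ 1 ℤ.+ i)
    identity = solve-∀

  floors-zero : ∀ {x} i j → x ≈ 0# → IsFloor x i → IsFloor (- x) j → 1# + (fromℤ i + fromℤ j) ≈ 1#
  floors-zero i j x≈0 ⌊x⌋ ⌊-x⌋ = begin
    1# + (fromℤ i + fromℤ j)
      ≈⟨ +-congˡ (+-cong (≡0 i x≈0 ⌊x⌋) (≡0 j (trans (-‿cong x≈0) (sym (fromℤ-neg 0ℤ))) ⌊-x⌋)) ⟩
    1# + (0# + 0#)             ≈⟨ trans (+-congˡ (+-identityʳ 0#)) (+-identityʳ 1#) ⟩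
    1#                         ∎
    where
    ≡0 : ∀ {y} k → y ≈ 0# → IsFloor y k → fromℤ k ≈ 0#
    ≡0 k y≈0 ⌊y⌋ = reflexive (≡.cong fromℤ
      (IsFloor-unique k 0ℤ y≈0 ⌊y⌋ (≤-refl , fromℤ-mono-< {0ℤ} {1ℤ} (ℤ.+<+ (ℕ.s≤s ℕ.z≤n)))))

  floors-nonInteger : ∀ {x} i j → (∀ k → ¬ x ≈ fromℤ k) → IsFloor x i → IsFloor (- x) j →
                      1# + (fromℤ i + fromℤ j) ≈ 0#
  floors-nonInteger {x} i j x∉ℤ ⌊x⌋ ⌊-x⌋ = begin
    1# + (fromℤ i + fromℤ j)
      ≡⟨ ≡.cong (λ j → 1# + (fromℤ i + fromℤ j))
        (IsFloor-unique j (ℤ.- ℤ.suc i) refl ⌊-x⌋ (IsFloor-neg i x∉ℤ ⌊x⌋)) ⟩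
    1# + (fromℤ i + fromℤ (ℤ.- ℤ.suc i))
      ≈⟨ +-congˡ (+-congˡ (trans (fromℤ-neg (ℤ.suc i)) (-‿cong (fromℤ-+ 1ℤ i)))) ⟩
    1# + (fromℤ i - (fromℤ 1ℤ + fromℤ i))       ≈⟨ +-congˡ (+-congˡ (-‿cong (+-congʳ fromℤ-1))) ⟩
    1# + (fromℤ i - (1# + fromℤ i))
      ≈⟨ solve 1 (λ x → con 1ℤ :+ (x :- (con 1ℤ :+ x)) := con 0ℤ) refl (fromℤ i) ⟩
    0#                                          ∎

  Irrational : Pred Carrier 0ℓ
  Irrational θ = ∀ {k} → k ≢ 0ℤ → ∀ j → ¬ θ * fromℤ k ≈ fromℤ j

  module _ {θ : Carrier} (θ∉ℚ : Irrational θ) where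

    -- For irrational θ and integral k, 1 + ⌊θk⌋ + ⌊-θk⌋ is the indicator of k = 0.
    set-zeros : ∀ {f} → GeneralisedPolynomial f → (∀ n → ∃[ k ] f n ≈ fromℤ k) →
                GeneralisedPolynomialSet (λ n → f n ≈ 0#)
    set-zeros {f} F f∈ℤ = helper (integerPart (scale θ F))
      (integerPart (respects neg (scale (- 1#) (scale θ F))))
      where
      neg : ∀ n → (- 1#) * (θ * f n) ≈ - (θ * f n)
      neg n = solve 1 (λ x → con -1ℤ :* x := :- x) refl (θ * f n)
      notInteger : ∀ {x k} → ¬ x ≈ 0# → x ≈ fromℤ k → ∀ j → ¬ θ * x ≈ fromℤ j
      notInteger {x} {k} x≉0 x≈k j eq = θ∉ℚ {k} (λ { ≡.refl → x≉0 x≈k }) j (trans (*-congˡ (sym x≈k)) eq)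
      helper : IntegerPart (λ n → θ * f n) → IntegerPart (λ n → - (θ * f n)) →
               GeneralisedPolynomialSet (λ n → f n ≈ 0#)
      helper (p , ⌊p⌋ , P) (q , ⌊q⌋ , Q) = (λ n → 1# + (fromℤ (p n) + fromℤ (q n))) ,
        (λ n → (λ f≈0 → floors-zero (p n) (q n) (trans (*-congˡ f≈0) (zeroʳ θ)) (⌊p⌋ n) (⌊q⌋ n))
             , (λ f≉0 → floors-nonInteger (p n) (q n) (notInteger {k = proj₁ (f∈ℤ n)} f≉0 (proj₂ (f∈ℤ n)))
               (⌊p⌋ n) (⌊q⌋ n))) ,
        add (constant 1#) (add P Q)

    module _ (N : ℕ) .{{_ : ℕ.NonZero N}} where

      private
        M = fromℤ (+ N)

        M≉0 : ¬ M ≈ 0#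
        M≉0 M≈0 = ℕ.≢-nonZero⁻¹ N (ℤₚ.+-injective (fromℤ-injective M≈0))

        remainder : ∀ g r q → fromℤ (g ℤ.- r ℤ.- + N ℤ.* q) ≈ (fromℤ g - fromℤ r) - M * fromℤ q
        remainder g r q = trans (fromℤ-difference (+ N ℤ.* q) (g ℤ.- r))
          (+-cong (fromℤ-difference r g) (-‿cong (fromℤ-* (+ N) q)))

        remainder≈0⇒≡ : ∀ g r q → (fromℤ g - fromℤ r) - M * fromℤ q ≈ 0# → g ≡ r ℤ.+ q ℤ.* + N
        remainder≈0⇒≡ g r q eq = ≡.trans (identity g r q (+ N))
          (≡.trans (≡.cong (λ d → r ℤ.+ q ℤ.* + N ℤ.+ d) (fromℤ-injective (trans (remainder g r q) eq)))
            (ℤₚ.+-identityʳ _))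
          where
          identity : ∀ g r q N → g ≡ r ℤ.+ q ℤ.* N ℤ.+ (g ℤ.- r ℤ.- N ℤ.* q)
          identity = solve-∀

        ≡⇒remainder≈0 : ∀ g r q z → IsFloor (M ⁻¹ * (fromℤ g - fromℤ r)) q → g ≡ r ℤ.+ z ℤ.* + N →
                        (fromℤ g - fromℤ r) - M * fromℤ q ≈ 0#
        ≡⇒remainder≈0 g r q z ⌊q⌋ eq = trans (+-cong diff (-‿cong (*-congˡ (reflexive (≡.cong fromℤ q≡z)))))
          (-‿inverseʳ _)
          where
          diff : fromℤ g - fromℤ r ≈ M * fromℤ z
          diff = begin
            fromℤ g - fromℤ r                        ≡⟨ ≡.cong (λ i → fromℤ i - fromℤ r) eq ⟩
            fromℤ (r ℤ.+ z ℤ.* + N) - fromℤ r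
              ≈⟨ +-congʳ (trans (fromℤ-+ r (z ℤ.* + N)) (+-congˡ (fromℤ-* z (+ N)))) ⟩
            fromℤ r + fromℤ z * M - fromℤ r
              ≈⟨ solve 3 (λ r z M → r :+ z :* M :- r := M :* z) refl (fromℤ r) (fromℤ z) M ⟩
            M * fromℤ z                              ∎
          quotient : M ⁻¹ * (fromℤ g - fromℤ r) ≈ fromℤ z
          quotient = *-cancelˡ-≈ M≉0 (begin
            M * (M ⁻¹ * (fromℤ g - fromℤ r))         ≈⟨ *-assoc M (M ⁻¹) _ ⟨
            M * M ⁻¹ * (fromℤ g - fromℤ r)           ≈⟨ *-congʳ (*-inverseʳ M M≉0) ⟩
            1# * (fromℤ g - fromℤ r)                 ≈⟨ *-identityˡ _ ⟩
            fromℤ g - fromℤ r                        ≈⟨ diff ⟩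
            M * fromℤ z                              ∎)
          q≡z : q ≡ z
          q≡z = IsFloor-unique q z quotient ⌊q⌋ (IsFloor-fromℤ z)

      -- g ≡ r modulo N exactly when the integer (g - r) - N⌊(g - r)/N⌋ vanishes, and this is a
      -- generalised polynomial, so that `set-zeros` applies.
      set-≡-mod : ∀ {g : ℤ → ℤ} → GeneralisedPolynomial (λ n → fromℤ (g n)) → ∀ r →
                  GeneralisedPolynomialSet (λ n → ∃[ z ] g n ≡ r ℤ.+ z ℤ.* + N)
      set-≡-mod {g} G r = helper (integerPart (scale (M ⁻¹) D))
        where
        D : GeneralisedPolynomial (λ n → fromℤ (g n) - fromℤ r)
        D = subtract G (constant (fromℤ r))
        helper : IntegerPart (λ n → M ⁻¹ * (fromℤ (g n) - fromℤ r)) →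
                 GeneralisedPolynomialSet (λ n → ∃[ z ] g n ≡ r ℤ.+ z ℤ.* + N)
        helper (q , ⌊q⌋ , Q) = set-⇔
          (λ n eq → q n , remainder≈0⇒≡ (g n) r (q n) eq)
          (λ { n (z , eq) → ≡⇒remainder≈0 (g n) r (q n) z (⌊q⌋ n) eq })
          (set-zeros (subtract D (scale M Q))
            (λ n → g n ℤ.- r ℤ.- + N ℤ.* q n , sym (remainder (g n) r (q n))))

      -- Split according to the residue r of g(n): on each of the N pieces g(n) may be replaced by
      -- the constant r. The predicate keeps its dependence on n so that the lemma can be iterated,
      -- one coordinate at a time.
      set-periodic : ∀ {P : ℤ → Pred ℤ 0ℓ} → (∀ r → GeneralisedPolynomialSet (P r)) →
                     (∀ r z n → P (r ℤ.+ z ℤ.* + N) n → P r n) →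
                     ∀ {g : ℤ → ℤ} → GeneralisedPolynomial (λ n → fromℤ (g n)) →
                     GeneralisedPolynomialSet (λ n → P (g n) n)
      set-periodic {P} X periodic {g} G = set-⇔ to from (set-⋃ (λ r → set-∩ (set-≡-mod G (+ r)) (X (+ r))) N)
        where
        to : ∀ n → (∃[ r ] r ℕ.< N × (∃[ z ] g n ≡ + r ℤ.+ z ℤ.* + N) × P (+ r) n) → P (g n) n
        to n (r , _ , (z , eq) , p) = periodic (g n) (ℤ.- z) n (≡.subst (λ i → P i n) (≡.sym shifted) p)
          where
          identity : ∀ r z N → r ℤ.+ z ℤ.* N ℤ.+ ℤ.- z ℤ.* N ≡ r
          identity = solve-∀
          shifted : g n ℤ.+ ℤ.- z ℤ.* + N ≡ + r
          shifted = ≡.trans (≡.cong (ℤ._+ (ℤ.- z ℤ.* + N)) eq) (identity (+ r) z (+ N))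
        from : ∀ n → P (g n) n → ∃[ r ] r ℕ.< N × (∃[ z ] g n ≡ + r ℤ.+ z ℤ.* + N) × P (+ r) n
        from n p = r , ℤ-DivMod.n%ℕd<d (g n) N , (z , eq) , periodic (+ r) z n (≡.subst (λ i → P i n) eq p)
          where
          r = g n ℤ-DivMod.%ℕ N
          z = g n ℤ-DivMod./ℕ N
          eq : g n ≡ + r ℤ.+ z ℤ.* + N
          eq = ℤ-DivMod.a≡a%ℕn+[a/ℕn]*n (g n) N

  -- Square roots

  square-cancel-< : ∀ {x y} → 0# < y → x * x < y * y → x < y
  square-cancel-< {x} {y} 0<y x²<y² with <⊎≥ x y
  ... | inj₁ x<y = x<y
  ... | inj₂ y≤x = ⊥-elim (≤⇒≯ y²≤x² x²<y²)
    where
    y²≤x² : y * y ≤ x * x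
    y²≤x² = ≤-fromDifference (solve 2 (λ x y → (x :- y) :* (x :- y) :+ con (+ 2) :* (y :* (x :- y))
      := x :* x :- y :* y) refl x y)
      (0≤-+ (0≤-square (x - y)) (0≤-* (0≤-fromℕ 2) (0≤-* (inj₁ 0<y) (≤⇒0≤difference y≤x))))

  -- The supremum s of all y with y² ≤ d satisfies s² = d, since otherwise a small shift h
  -- contradicts its being the supremum. This will turn a non-negative discriminant into real roots.
  sqrt : ∀ d → 0# ≤ d → ∃[ e ] e * e ≈ d
  sqrt d 0≤d with complete (λ y → y * y ≤ d) (0# , ≤-respˡ-≈ (sym (zeroˡ 0#)) 0≤d) (1# + d , bound)
    where
    bound : UpperBound (λ y → y * y ≤ d) (1# + d)
    bound y y²≤d with <⊎≥ (1# + d) y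
    ... | inj₂ y≤1+d = y≤1+d
    ... | inj₁ 1+d<y = inj₁ (square-cancel-< (0<-+ 0<1 0≤d) (≤-<-trans y²≤d
      (<-fromDifference (solve 1 (λ d → con 1ℤ :+ (d :+ d :* d) := (con 1ℤ :+ d) :* (con 1ℤ :+ d) :- d)
        refl d)
        (0<-+ 0<1 (0≤-+ 0≤d (0≤-square d))))))
  ... | s , upper , approx with compare (s * s) d
  ...   | tri≈ _ s²≈d _ = s , s²≈d
  ...   | tri< s²<d _ _ = ⊥-elim (≤⇒≯ (upper (s + h) (inj₁ [s+h]²<d)) s<s+h)
    where
    0≤s : 0# ≤ s
    0≤s = upper 0# (≤-respˡ-≈ (sym (zeroˡ 0#)) 0≤d)
    ε k h : Carrier
    ε = d - s * s
    -- The summand `ε` forces h < 1, and then h(2s + h) < hk = ε, which says (s + h)² < d.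
    k = 1# + (fromℕ 2 * s + ε)
    0<ε : 0# < ε
    0<ε = <⇒0<difference s²<d
    0<k : 0# < k
    0<k = 0<-+ 0<1 (0≤-+ (0≤-* (0≤-fromℕ 2) 0≤s) (inj₁ 0<ε))
    h = ε * k ⁻¹
    0<h : 0# < h
    0<h = *-pos 0<ε (0<-⁻¹ 0<k)
    hk≈ε : h * k ≈ ε
    hk≈ε = x*k⁻¹*k≈x ε 0<k
    s<s+h : s < s + h
    s<s+h = <-fromDifference (solve 2 (λ s h → h := s :+ h :- s) refl s h) 0<h
    h<1 : h < 1#
    h<1 = *-cancelˡ-< 0<k (<-respˡ-≈ (trans (sym hk≈ε) (*-comm h k)) (<-respʳ-≈ (sym (*-identityʳ k))
      (<-fromDifference (solve 2 (λ s e → con 1ℤ :+ con (+ 2) :* s := con 1ℤ :+ (con (+ 2) :* s :+ e) :- e)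
        refl s ε)
        (0<-+ 0<1 (0≤-* (0≤-fromℕ 2) 0≤s)))))
    [s+h]²<d : (s + h) * (s + h) < d
    [s+h]²<d = <-fromDifference
      (begin
        h * (1# - h) + h * ε
          ≈⟨ solve 3 (λ h e s → h :* (con 1ℤ :- h) :+ h :* e
            := h :* (con 1ℤ :+ (con (+ 2) :* s :+ e)) :- h :* (con (+ 2) :* s :+ h)) refl h ε s ⟩
        h * k - h * (fromℕ 2 * s + h)                          ≈⟨ +-congʳ hk≈ε ⟩
        (d - s * s) - h * (fromℕ 2 * s + h)
          ≈⟨ solve 3 (λ d s h → (d :- s :* s) :- h :* (con (+ 2) :* s :+ h) := d :- (s :+ h) :* (s :+ h))
            refl d s h ⟩
        d - (s + h) * (s + h)                                      ∎)
      (0<-+ (*-pos 0<h (<⇒0<difference h<1)) (inj₁ (*-pos 0<h 0<ε)))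
  ...   | tri> _ _ d<s² = ⊥-elim (absurd (approx y y<s))
    where
    0≤s : 0# ≤ s
    0≤s = upper 0# (≤-respˡ-≈ (sym (zeroˡ 0#)) 0≤d)
    ε k h y : Carrier
    ε = s * s - d
    -- From h(1 + 2s) = s² - d one gets y² - d = h + h² > 0, so that no element of the set exceeds
    -- y, although y < s.
    k = 1# + fromℕ 2 * s
    h = ε * k ⁻¹
    y = s - h
    0<ε : 0# < ε
    0<ε = <⇒0<difference d<s²
    0<k : 0# < k
    0<k = 0<-+ 0<1 (0≤-* (0≤-fromℕ 2) 0≤s)
    0<h : 0# < h
    0<h = *-pos 0<ε (0<-⁻¹ 0<k)
    hk≈ε : h * k ≈ ε
    hk≈ε = x*k⁻¹*k≈x ε 0<k
    y<s : y < s
    y<s = <-fromDifference (solve 2 (λ s h → h := s :- (s :- h)) refl s h) 0<h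
    d<y² : d < y * y
    d<y² = <-fromDifference
      (begin
        h + h * h
          ≈⟨ solve 2 (λ h s → h :+ h :* h := h :* (con 1ℤ :+ con (+ 2) :* s) :- con (+ 2) :* s :* h :+ h :* h)
            refl h s ⟩
        h * k - fromℕ 2 * s * h + h * h                        ≈⟨ +-congʳ (+-congʳ hk≈ε) ⟩
        (s * s - d) - fromℕ 2 * s * h + h * h
          ≈⟨ solve 3 (λ d s h → (s :* s :- d) :- con (+ 2) :* s :* h :+ h :* h := (s :- h) :* (s :- h) :- d)
            refl d s h ⟩
        y * y - d                                                  ∎)
      (0<-+ 0<h (0≤-square h))
    -- h(1 + 2s) = s² - d gives h ≤ s.
    0≤y : 0# ≤ y
    0≤y = ≮⇒≥ λ y<0 → ≤⇒≯ (0≤-+ (0≤-+ 0≤d (inj₁ 0<h)) (0≤-* 0≤s (inj₁ 0<h)))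
      (<-respˡ-≈ (begin
         s * (s - h)
           ≈⟨ solve 3 (λ d s h → s :* (s :- h) := (s :* s :- d) :+ d :- s :* h) refl d s h ⟩
         (s * s - d) + d - s * h                                   ≈⟨ +-congʳ (+-congʳ hk≈ε) ⟨
         h * k + d - s * h
           ≈⟨ solve 3 (λ d s h → h :* (con 1ℤ :+ con (+ 2) :* s) :+ d :- s :* h := d :+ h :+ s :* h)
             refl d s h ⟩
         d + h + s * h                                             ∎)
       (<-respʳ-≈ (zeroʳ s) (*-monoˡ-< 0<s y<0)))
      where
      0<s : 0# < s
      0<s with 0≤s
      ... | inj₁ p = p
      ... | inj₂ 0≈s = ⊥-elim (≤⇒≯ 0≤d (<-respʳ-≈ (trans (*-congʳ (sym 0≈s)) (zeroˡ s)) d<s²))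
    absurd : ¬ (∃[ x ] x * x ≤ d × y < x)
    absurd (x , x²≤d , y<x) = ≤⇒≯ x²≤d (<-≤-trans d<y²
      (≤-fromDifference (solve 2 (λ x y → (x :- y) :* (x :- y) :+ con (+ 2) :* (y :* (x :- y))
        := x :* x :- y :* y) refl x y)
        (0≤-+ (0≤-square (x - y)) (0≤-* (0≤-fromℕ 2) (0≤-* 0≤y (≤⇒0≤difference (inj₁ y<x)))))))

  -- Growth of powers

  module Powers {β : Carrier} (1<β : 1# < β) where

    0<β : 0# < β
    0<β = <-trans 0<1 1<β

    0<β^ : ∀ n → 0# < β ^ n
    0<β^ zero    = 0<1
    0<β^ (suc n) = *-pos 0<β (0<β^ n)

    bernoulli : ∀ n → 1# + fromℤ (+ n) * (β - 1#) ≤ β ^ n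
    bernoulli zero    = inj₂ (trans (+-congˡ (zeroˡ _)) (+-identityʳ 1#))
    bernoulli (suc n) = ≤-trans
      (≤-fromDifference
        (solve 2 (λ n β → n :* ((β :- con 1ℤ) :* (β :- con 1ℤ)) :=
            β :* (con 1ℤ :+ n :* (β :- con 1ℤ)) :- (con 1ℤ :+ (con 1ℤ :+ n) :* (β :- con 1ℤ)))
          refl (fromℤ (+ n)) β)
        (0≤-* (0≤-fromℤ n) (0≤-square (β - 1#))))
      (*-monoˡ-≤ (inj₁ 0<β) (bernoulli n))

    ^-unbounded : ∀ x → ∃[ n ] x < β ^ n
    ^-unbounded x with archimedean (x * (β - 1#) ⁻¹)
    ... | n , x/β-1<n = n , <-≤-trans x<n[β-1] (≤-trans (inj₁ n[β-1]<) (bernoulli n))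
      where
      0<β-1 : 0# < β - 1#
      0<β-1 = <⇒0<difference 1<β
      x<n[β-1] : x < (β - 1#) * fromℤ (+ n)
      x<n[β-1] = <-respˡ-≈
        (trans (trans (solve 3 (λ c x d → c :* (x :* d) := (c :* d) :* x) refl (β - 1#) x _)
          (*-congʳ (*-inverseʳ _ (0<⇒≉0 0<β-1)))) (*-identityˡ x))
        (*-monoˡ-< 0<β-1 x/β-1<n)
      n[β-1]< : (β - 1#) * fromℤ (+ n) < 1# + fromℤ (+ n) * (β - 1#)
      n[β-1]< = <-fromDifference (solve 2 (λ c n → con 1ℤ := con 1ℤ :+ n :* c :- c :* n)
        refl (β - 1#) (fromℤ (+ n))) 0<1

    ^-mono-≤ : ∀ {m n} → m ℕ.≤ n → β ^ m ≤ β ^ n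
    ^-mono-≤ {m} {n} m≤n = ≡.subst (λ k → β ^ m ≤ β ^ k) (ℕₚ.m+[n∸m]≡n m≤n)
      (≤-respʳ-≈ (sym (^-homo-* β m (n ℕ.∸ m)))
        (≤-respˡ-≈ (*-identityʳ _) (*-monoˡ-≤ (inj₁ (0<β^ m)) (1≤β^ (n ℕ.∸ m)))))
      where
      1≤β^ : ∀ k → 1# ≤ β ^ k
      1≤β^ zero    = ≤-refl
      1≤β^ (suc k) = ≤-trans (1≤β^ k) (≤-respˡ-≈ (*-identityʳ _)
        (≤-respʳ-≈ (*-comm _ _) (*-monoˡ-≤ (inj₁ (0<β^ k)) (inj₁ 1<β))))

  -- The order ℤ[β], its trace and its norm

  -- s and p are the trace and the norm of a complex root α of the cubic.
  module CubicField (a b : ℤ) (β s p : Carrier) (1<β : 1# < β) (βp≈1 : β * p ≈ 1#)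
    (a≈ : fromℤ a ≈ β + s) (b≈ : fromℤ b ≈ - (β * s + p)) (s²<4p : s * s < fromℕ 4 * p) where

    open Powers 1<β

    0<p : 0# < p
    0<p = *-cancelˡ-< 0<β (<-respˡ-≈ (sym (zeroʳ β)) (<-respʳ-≈ (sym βp≈1) 0<1))

    p<1 : p < 1#
    p<1 = *-cancelˡ-< 0<β (<-respˡ-≈ (sym βp≈1) (<-respʳ-≈ (sym (*-identityʳ β)) 1<β))

    -- conjugateNormℝ u v w is |u + vα + wα²|².
    valueℝ conjugateNormℝ : Carrier → Carrier → Carrier → Carrier
    valueℝ u v w = u + β * v + β * β * w
    conjugateNormℝ u v w =
      u * u + s * u * v + (s * s - fromℕ 2 * p) * u * w + p * v * v + p * s * v * w + p * p * w * w

    private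
      conjugateNormₚ : ∀ {n} (s p u v w : Polynomial n) → Polynomial n
      conjugateNormₚ s p u v w =
        u :* u :+ s :* u :* v :+ (s :* s :- con (+ 2) :* p) :* u :* w :+ p :* v :* v :+ p :* s :* v :* w
          :+ p :* p :* w :* w

    value conjugateNorm : Triple → Carrier
    value ⟨ u , v , w ⟩ = valueℝ (fromℤ u) (fromℤ v) (fromℤ w)
    conjugateNorm ⟨ u , v , w ⟩ = conjugateNormℝ (fromℤ u) (fromℤ v) (fromℤ w)

    valueℝ-cong : ∀ {u u′ v v′ w w′} → u ≈ u′ → v ≈ v′ → w ≈ w′ → valueℝ u v w ≈ valueℝ u′ v′ w′
    valueℝ-cong u≈ v≈ w≈ = +-cong (+-cong u≈ (*-congˡ v≈)) (*-congˡ w≈)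

    conjugateNormℝ-cong : ∀ {u u′ v v′ w w′} → u ≈ u′ → v ≈ v′ → w ≈ w′ →
                          conjugateNormℝ u v w ≈ conjugateNormℝ u′ v′ w′
    conjugateNormℝ-cong u≈ v≈ w≈ =
      +-cong (+-cong (+-cong (+-cong (+-cong (*-cong u≈ u≈) (*-cong (*-congˡ u≈) v≈))
        (*-cong (*-congˡ u≈) w≈))
        (*-cong (*-congˡ v≈) v≈)) (*-cong (*-congˡ v≈) w≈)) (*-cong (*-congˡ w≈) w≈)

    -- As α² = sα - p, the conjugate of the triple is y + zα with y = u - pw and z = v + sw.
    -- Multiplication by 4 completes the square in y² + syz + pz², and s² < 4p makes the form
    -- positive definite.
    conjugateNormℝ-identity : ∀ u v w → fromℕ 4 * conjugateNormℝ u v w ≈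
      (fromℕ 2 * (u - p * w) + s * (v + s * w)) * (fromℕ 2 * (u - p * w) + s * (v + s * w))
        + (fromℕ 4 * p - s * s) * ((v + s * w) * (v + s * w))
    conjugateNormℝ-identity u v w = solve 5 (λ s p u v w →
      con (+ 4) :* conjugateNormₚ s p u v w
      := (con (+ 2) :* (u :- p :* w) :+ s :* (v :+ s :* w)) :* (con (+ 2) :* (u :- p :* w)
        :+ s :* (v :+ s :* w))
         :+ (con (+ 4) :* p :- s :* s) :* ((v :+ s :* w) :* (v :+ s :* w))) refl s p u v w

    0≤conjugateNormℝ : ∀ u v w → 0# ≤ conjugateNormℝ u v w
    0≤conjugateNormℝ u v w = ≮⇒≥ λ q<0 → ≤⇒≯
      (≤-respʳ-≈ (sym (conjugateNormℝ-identity u v w))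
        (0≤-+ (0≤-square _) (0≤-* (inj₁ (<⇒0<difference s²<4p)) (0≤-square _))))
      (<-respʳ-≈ (zeroʳ (fromℕ 4)) (*-monoˡ-< (0<-fromℕ 3) q<0))

    0≤conjugateNorm : ∀ x → 0# ≤ conjugateNorm x
    0≤conjugateNorm ⟨ u , v , w ⟩ = 0≤conjugateNormℝ (fromℤ u) (fromℤ v) (fromℤ w)

    value-⊕ : ∀ x y → value (x ⊕ y) ≈ value x + value y
    value-⊕ ⟨ u , v , w ⟩ ⟨ u′ , v′ , w′ ⟩ = trans (valueℝ-cong (fromℤ-+ u u′) (fromℤ-+ v v′) (fromℤ-+ w w′))
      (solve 7 (λ β u v w u′ v′ w′ → (u :+ u′) :+ β :* (v :+ v′) :+ β :* β :* (w :+ w′)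
        := (u :+ β :* v :+ β :* β :* w) :+ (u′ :+ β :* v′ :+ β :* β :* w′))
          refl β (fromℤ u) (fromℤ v) (fromℤ w) (fromℤ u′) (fromℤ v′) (fromℤ w′))

    value-⊝ : ∀ x y → value (x ⊝ y) ≈ value x - value y
    value-⊝ ⟨ u , v , w ⟩ ⟨ u′ , v′ , w′ ⟩ = trans
      (valueℝ-cong (fromℤ-difference u′ u) (fromℤ-difference v′ v) (fromℤ-difference w′ w))
      (solve 7 (λ β u v w u′ v′ w′ → (u :- u′) :+ β :* (v :- v′) :+ β :* β :* (w :- w′)
        := (u :+ β :* v :+ β :* β :* w) :- (u′ :+ β :* v′ :+ β :* β :* w′))
          refl β (fromℤ u) (fromℤ v) (fromℤ w) (fromℤ u′) (fromℤ v′) (fromℤ w′))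

    parallelogram : ∀ x y → conjugateNorm (x ⊕ y) + conjugateNorm (x ⊝ y) ≈
                            fromℕ 2 * (conjugateNorm x + conjugateNorm y)
    parallelogram ⟨ u , v , w ⟩ ⟨ u′ , v′ , w′ ⟩ = trans
      (+-cong (conjugateNormℝ-cong (fromℤ-+ u u′) (fromℤ-+ v v′) (fromℤ-+ w w′))
              (conjugateNormℝ-cong (fromℤ-difference u′ u) (fromℤ-difference v′ v) (fromℤ-difference w′ w)))
      (solve 8 (λ s p u v w u′ v′ w′ →
        let q = conjugateNormₚ s p in
        q (u :+ u′) (v :+ v′) (w :+ w′) :+ q (u :- u′) (v :- v′) (w :- w′)
          := con (+ 2) :* (q u v w :+ q u′ v′ w′))
        refl s p (fromℤ u) (fromℤ v) (fromℤ w) (fromℤ u′) (fromℤ v′) (fromℤ w′))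

    -- A non-negative term of the parallelogram law is dropped. The result serves as a triangle
    -- inequality for |σ| without square roots, at the price of the factor 2.
    conjugateNorm-⊝-≤ : ∀ x y → conjugateNorm (x ⊝ y) ≤ fromℕ 2 * (conjugateNorm x + conjugateNorm y)
    conjugateNorm-⊝-≤ x y = ≤-fromDifference
      (trans (solve 2 (λ c d → c := (c :+ d) :- d) refl (conjugateNorm (x ⊕ y)) (conjugateNorm (x ⊝ y)))
        (+-congʳ (parallelogram x y)))
      (0≤conjugateNorm (x ⊕ y))

    -- Multiplication by β, reduced with β³ = 1 + bβ + aβ².
    mulβ : Triple → Triple
    mulβ ⟨ u , v , w ⟩ = ⟨ w , u ℤ.+ b ℤ.* w , v ℤ.+ a ℤ.* w ⟩

    private
      -- The coefficients 1, b and a are replaced by symmetric functions of the roots: βp, -(βs + p)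
      -- and β + s. The multiplicativity of value and conjugate norm then consists of polynomial
      -- identities in β, s and p.
      mulβℝ : ∀ u v w → (fromℤ w ≈ β * p * fromℤ w) × (fromℤ (u ℤ.+ b ℤ.* w)
        ≈ fromℤ u - (β * s + p) * fromℤ w) ×
                        (fromℤ (v ℤ.+ a ℤ.* w) ≈ fromℤ v + (β + s) * fromℤ w)
      mulβℝ u v w =
        trans (sym (*-identityˡ _)) (*-congʳ (sym βp≈1)) ,
        (begin
          fromℤ (u ℤ.+ b ℤ.* w)                ≈⟨ trans (fromℤ-+ u (b ℤ.* w)) (+-congˡ (fromℤ-* b w)) ⟩
          fromℤ u + fromℤ b * fromℤ w          ≈⟨ +-congˡ (*-congʳ b≈) ⟩
          fromℤ u + - (β * s + p) * fromℤ w
            ≈⟨ solve 3 (λ u c w → u :+ (:- c) :* w := u :- c :* w) refl (fromℤ u) (β * s + p) (fromℤ w) ⟩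
          fromℤ u - (β * s + p) * fromℤ w      ∎) ,
        trans (fromℤ-+ v (a ℤ.* w)) (+-congˡ (trans (fromℤ-* a w) (*-congʳ a≈)))

    value-mulβ : ∀ x → value (mulβ x) ≈ β * value x
    value-mulβ ⟨ u , v , w ⟩ with mulβℝ u v w
    ... | u≈ , v≈ , w≈ = trans (valueℝ-cong u≈ v≈ w≈)
      (solve 6 (λ β s p u v w → (β :* p :* w) :+ β :* (u :- (β :* s :+ p) :* w)
        :+ β :* β :* (v :+ (β :+ s) :* w)
        := β :* (u :+ β :* v :+ β :* β :* w)) refl β s p (fromℤ u) (fromℤ v) (fromℤ w))

    conjugateNorm-mulβ : ∀ x → conjugateNorm (mulβ x) ≈ p * conjugateNorm x
    conjugateNorm-mulβ ⟨ u , v , w ⟩ with mulβℝ u v w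
    ... | u≈ , v≈ , w≈ = trans (conjugateNormℝ-cong u≈ v≈ w≈)
      (solve 6 (λ β s p u v w →
        let q = conjugateNormₚ s p in
        q (β :* p :* w) (u :- (β :* s :+ p) :* w) (v :+ (β :+ s) :* w) := p :* q u v w)
        refl β s p (fromℤ u) (fromℤ v) (fromℤ w))

    mulβ-isLinear : IsLinear mulβ
    mulβ-isLinear = record
      { ⊕-homo = λ { ⟨ u , v , w ⟩ ⟨ u′ , v′ , w′ ⟩ → triple-≡ ≡.refl (⊕-identity b u u′ w w′)
        (⊕-identity a v v′ w w′) }
      ; ⊙-homo = λ { k ⟨ u , v , w ⟩ → triple-≡ ≡.refl (⊙-identity b k u w) (⊙-identity a k v w) }
      }
      where
      ⊕-identity = ℤ-solve 5 (λ a u u′ w w′ → (u ⊞ u′) ⊞ a ⊠ (w ⊞ w′) ⩵ (u ⊞ a ⊠ w) ⊞ (u′ ⊞ a ⊠ w′)) ≡.refl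
      ⊙-identity = ℤ-solve 4 (λ a k u w → k ⊠ u ⊞ a ⊠ (k ⊠ w) ⩵ k ⊠ (u ⊞ a ⊠ w)) ≡.refl

    mulβ-relation : ∀ x → mulβ (mulβ (mulβ x)) ≡ a ⊙ mulβ (mulβ x) ⊝ (ℤ.- b) ⊙ mulβ x ⊕ x
    mulβ-relation ⟨ u , v , w ⟩ = triple-≡ (identity₁ a b u v w) (identity₂ a b u v w) (identity₃ a b u v w)
      where
      identity₁ = ℤ-solve 5 (λ a b u v w → u ⊞ b ⊠ w ⊞ a ⊠ (v ⊞ a ⊠ w)
        ⩵ a ⊠ (v ⊞ a ⊠ w) ⊟ (⊟ b) ⊠ w ⊞ u) ≡.refl
      identity₂ = ℤ-solve 5 (λ a b u v w → (v ⊞ a ⊠ w) ⊞ b ⊠ (u ⊞ b ⊠ w ⊞ a ⊠ (v ⊞ a ⊠ w))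
        ⩵ a ⊠ (w ⊞ b ⊠ (v ⊞ a ⊠ w)) ⊟ (⊟ b) ⊠ (u ⊞ b ⊠ w) ⊞ v) ≡.refl
      identity₃ = ℤ-solve 5 (λ a b u v w → (w ⊞ b ⊠ (v ⊞ a ⊠ w)) ⊞ a ⊠ (u ⊞ b ⊠ w ⊞ a ⊠ (v ⊞ a ⊠ w))
        ⩵ a ⊠ (u ⊞ b ⊠ w ⊞ a ⊠ (v ⊞ a ⊠ w)) ⊟ (⊟ b) ⊠ (v ⊞ a ⊠ w) ⊞ w) ≡.refl

    IsInteger : Pred Carrier 0ℓ
    IsInteger r = ∃[ k ] r ≈ fromℤ k

    integer-+ : ∀ {x y} → IsInteger x → IsInteger y → IsInteger (x + y)
    integer-+ (i , x≈i) (j , y≈j) = i ℤ.+ j , trans (+-cong x≈i y≈j) (sym (fromℤ-+ i j))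

    integer-* : ∀ {x y} → IsInteger x → IsInteger y → IsInteger (x * y)
    integer-* (i , x≈i) (j , y≈j) = i ℤ.* j , trans (*-cong x≈i y≈j) (sym (fromℤ-* i j))

    integer-- : ∀ {x y} → IsInteger x → IsInteger y → IsInteger (x - y)
    integer-- (i , x≈i) (j , y≈j) = i ℤ.- j , trans (+-cong x≈i (-‿cong y≈j)) (sym (fromℤ-difference j i))

    integer-fromℤ : ∀ i → IsInteger (fromℤ i)
    integer-fromℤ i = i , refl

    integer-fromℕ : ∀ n → IsInteger (fromℕ n)
    integer-fromℕ n = + n , sym (fromℕ≈ n)

    private
      e₁∈ℤ : IsInteger (β + s)
      e₁∈ℤ = a , sym a≈

      e₂∈ℤ : IsInteger (β * s + p)
      e₂∈ℤ = ℤ.- b , sym (trans (fromℤ-neg b)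
        (trans (-‿cong b≈) (solve 1 (λ x → :- (:- x) := x) refl (β * s + p))))

      e₃∈ℤ : IsInteger (β * p)
      e₃∈ℤ = 1ℤ , trans βp≈1 (sym fromℤ-1)

    -- The product over the three embeddings is symmetric in β, α and the complex conjugate of α.
    -- Hence it is an integral polynomial in the elementary symmetric functions e₁ = a, e₂ = -b and
    -- e₃ = 1 of the roots; `norm` below is this expansion.
    norm∈ℤ : ∀ x → IsInteger (value x * conjugateNorm x)
    norm∈ℤ ⟨ u , v , w ⟩ = proj₁ isInteger , trans (identity (fromℤ u) (fromℤ v) (fromℤ w)) (proj₂ isInteger)
      where
      norm : Carrier → Carrier → Carrier → Carrier → Carrier → Carrier → Carrier
      norm e₁ e₂ e₃ u v w =
        u * u * u + e₁ * u * u * v + (e₁ * e₁ - fromℕ 2 * e₂) * u * u * w + e₂ * u * v * v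
        + (e₁ * e₂ - fromℕ 3 * e₃) * u * v * w + (e₂ * e₂ - fromℕ 2 * e₁ * e₃) * u * w * w
        + e₃ * v * v * v + e₁ * e₃ * v * v * w + e₂ * e₃ * v * w * w + e₃ * e₃ * w * w * w
      identity : ∀ u v w → valueℝ u v w * conjugateNormℝ u v w ≈ norm (β + s) (β * s + p) (β * p) u v w
      identity u v w = solve 6 (λ β s p u v w →
        let e₁ = β :+ s
            e₂ = β :* s :+ p
            e₃ = β :* p in
        (u :+ β :* v :+ β :* β :* w) :* conjugateNormₚ s p u v w
        := u :* u :* u :+ e₁ :* u :* u :* v :+ (e₁ :* e₁ :- con (+ 2) :* e₂) :* u :* u :* w
          :+ e₂ :* u :* v :* v
        :+ (e₁ :* e₂ :- con (+ 3) :* e₃) :* u :* v :* w :+ (e₂ :* e₂ :- con (+ 2) :* e₁ :* e₃) :* u :* w :* w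
        :+ e₃ :* v :* v :* v :+ e₁ :* e₃ :* v :* v :* w :+ e₂ :* e₃ :* v :* w :* w :+ e₃ :* e₃ :* w :* w :* w)
          refl β s p u v w
      isInteger : IsInteger (norm (β + s) (β * s + p) (β * p) (fromℤ u) (fromℤ v) (fromℤ w))
      isInteger =
        u′ ∙ u′ ∙ u′ ⊹ e₁∈ℤ ∙ u′ ∙ u′ ∙ v′ ⊹ integer-- (e₁∈ℤ ∙ e₁∈ℤ)
          (integer-fromℕ 2 ∙ e₂∈ℤ) ∙ u′ ∙ u′ ∙ w′ ⊹ e₂∈ℤ ∙ u′ ∙ v′ ∙ v′
        ⊹ integer-- (e₁∈ℤ ∙ e₂∈ℤ) (integer-fromℕ 3 ∙ e₃∈ℤ) ∙ u′ ∙ v′ ∙ w′ ⊹ integer-- (e₂∈ℤ ∙ e₂∈ℤ)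
          (integer-fromℕ 2 ∙ e₁∈ℤ ∙ e₃∈ℤ) ∙ u′ ∙ w′ ∙ w′
        ⊹ e₃∈ℤ ∙ v′ ∙ v′ ∙ v′ ⊹ e₁∈ℤ ∙ e₃∈ℤ ∙ v′ ∙ v′ ∙ w′ ⊹ e₂∈ℤ ∙ e₃∈ℤ ∙ v′ ∙ w′ ∙ w′ ⊹ e₃∈ℤ ∙ e₃∈ℤ ∙ w′ ∙ w′ ∙ w′
        where
        infixl 6 _⊹_
        infixl 7 _∙_
        _⊹_ = integer-+
        _∙_ = integer-*
        u′ = integer-fromℤ u
        v′ = integer-fromℤ v
        w′ = integer-fromℤ w

    -- The coefficients of u, v and w are the traces of 1, β and β², that is 3, e₁ and e₁² - 2e₂.
    trace∈ℤ : ∀ u v w → IsInteger (valueℝ (fromℤ u) (fromℤ v)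
      (fromℤ w) + (fromℕ 2 * (fromℤ u - p * fromℤ w) + s * (fromℤ v + s * fromℤ w)))
    trace∈ℤ u v w = proj₁ isInteger , trans identity (proj₂ isInteger)
      where
      identity : valueℝ (fromℤ u) (fromℤ v)
        (fromℤ w) + (fromℕ 2 * (fromℤ u - p * fromℤ w) + s * (fromℤ v + s * fromℤ w)) ≈
        fromℕ 3 * fromℤ u + (β + s) * fromℤ v + ((β + s) * (β + s) - fromℕ 2 * (β * s + p)) * fromℤ w
      identity = solve 6 (λ β s p u v w →
        (u :+ β :* v :+ β :* β :* w) :+ (con (+ 2) :* (u :- p :* w) :+ s :* (v :+ s :* w))
        := con (+ 3) :* u :+ (β :+ s) :* v :+ ((β :+ s) :* (β :+ s) :- con (+ 2) :* (β :* s :+ p)) :* w)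
        refl β s p (fromℤ u) (fromℤ v) (fromℤ w)
      isInteger : IsInteger
        (fromℕ 3 * fromℤ u + (β + s) * fromℤ v + ((β + s) * (β + s) - fromℕ 2 * (β * s + p)) * fromℤ w)
      isInteger = integer-+
        (integer-+ (integer-* (integer-fromℕ 3) (integer-fromℤ u)) (integer-* e₁∈ℤ (integer-fromℤ v)))
        (integer-* (integer-- (integer-* e₁∈ℤ e₁∈ℤ) (integer-* (integer-fromℕ 2) e₂∈ℤ)) (integer-fromℤ w))

    -- Irrationality of β and injectivity of the complex embedding

    -- If n, nβ and nβ² are integers, then so is n/β = nβ² - anβ - bn.
    private
      descent : ∀ n {k m₁ m₂} → 0# < fromℤ k → k ℤ.≤ + n →
                β * fromℤ k ≈ fromℤ m₁ → β * fromℤ m₁ ≈ fromℤ m₂ → ⊥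
      descent zero    0<k k≤n _ _ = ≤⇒≯ (fromℤ-mono-≤ k≤n) 0<k
      descent (suc n) {k} {m₁} {m₂} 0<k k≤1+n βk≈m₁ βm₁≈m₂ = descent n {k′} {k} {m₁} 0<k′ k′≤n βk′≈k βk≈m₁
        where
        k′ : ℤ
        k′ = m₂ ℤ.- a ℤ.* m₁ ℤ.- b ℤ.* k
        k′≈ : fromℤ k′ ≈ p * fromℤ k
        k′≈ = begin
          fromℤ k′
            ≈⟨ trans (fromℤ-difference (b ℤ.* k) (m₂ ℤ.- a ℤ.* m₁))
              (+-cong (trans (fromℤ-difference (a ℤ.* m₁) m₂) (+-congˡ (-‿cong (fromℤ-* a m₁))))
              (-‿cong (fromℤ-* b k))) ⟩
          fromℤ m₂ - fromℤ a * fromℤ m₁ - fromℤ b * fromℤ k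
            ≈⟨ +-cong (+-cong (trans (sym βm₁≈m₂) (*-congˡ (sym βk≈m₁))) (-‿cong (*-cong a≈ (sym βk≈m₁))))
              (-‿cong (*-congʳ b≈)) ⟩
          β * (β * fromℤ k) - (β + s) * (β * fromℤ k) - - (β * s + p) * fromℤ k
            ≈⟨ solve 4 (λ β s p k → β :* (β :* k) :- (β :+ s) :* (β :* k) :- (:- (β :* s :+ p)) :* k
              := p :* k) refl β s p (fromℤ k) ⟩
          p * fromℤ k ∎
        0<k′ : 0# < fromℤ k′
        0<k′ = <-respʳ-≈ (sym k′≈) (*-pos 0<p 0<k)
        k′≤n : k′ ℤ.≤ + n
        k′≤n = i<suc[j]⇒i≤j (ℤₚ.<-≤-trans (fromℤ-cancel-< {k′} {k} (<-respˡ-≈ (trans (*-comm _ _) (sym k′≈))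
          (<-respʳ-≈ (*-identityʳ _) (*-monoˡ-< 0<k p<1)))) k≤1+n)
        βk′≈k : β * fromℤ k′ ≈ fromℤ k
        βk′≈k = trans (*-congˡ k′≈) (trans (sym (*-assoc β p _)) (trans (*-congʳ βp≈1) (*-identityˡ _)))

    β-irrational : Irrational β
    -- The descent starts from n = k², which is positive whatever the sign of k and makes both nβ =
    -- jk and nβ² = j² integers.
    β-irrational {k} k≢0 j βk≈j = descent ℤ.∣ k ℤ.* k ∣ {k ℤ.* k} {j ℤ.* k} {j ℤ.* j} 0<k² (≤∣∣ (k ℤ.* k))
      (begin
        β * fromℤ (k ℤ.* k)        ≈⟨ *-congˡ (fromℤ-* k k) ⟩
        β * (fromℤ k * fromℤ k)    ≈⟨ *-assoc _ _ _ ⟨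
        β * fromℤ k * fromℤ k      ≈⟨ *-congʳ βk≈j ⟩
        fromℤ j * fromℤ k          ≈⟨ fromℤ-* j k ⟨
        fromℤ (j ℤ.* k)            ∎)
      (begin
        β * fromℤ (j ℤ.* k)        ≈⟨ *-congˡ (fromℤ-* j k) ⟩
        β * (fromℤ j * fromℤ k)
          ≈⟨ solve 3 (λ β j k → β :* (j :* k) := j :* (β :* k)) refl β (fromℤ j) (fromℤ k) ⟩
        fromℤ j * (β * fromℤ k)    ≈⟨ *-congˡ βk≈j ⟩
        fromℤ j * fromℤ j          ≈⟨ fromℤ-* j j ⟨
        fromℤ (j ℤ.* j)            ∎)
      where
      0<k² : 0# < fromℤ (k ℤ.* k)
      0<k² = <-respʳ-≈ (sym (fromℤ-* k k)) (0<-square (λ k≈0 → k≢0 (fromℤ-injective k≈0)))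
      ≤∣∣ : ∀ i → i ℤ.≤ + ℤ.∣ i ∣
      ≤∣∣ (+ n)    = ℤₚ.≤-refl
      ≤∣∣ -[1+ n ] = ℤ.-≤+

    -- The factor X² - sX + p of the cubic, evaluated at β; it equals |β - α|². Division of u + vX +
    -- wX² by this factor leaves (u - pw) + (v + sw)X, which is the source of `value-identity`.
    δ : Carrier
    δ = β * β - β * s + p

    value-identity : ∀ u v w → valueℝ u v w ≈ (u - p * w) + β * (v + s * w) + δ * w
    value-identity = solve 6 (λ β s p u v w → u :+ β :* v :+ β :* β :* w
      := (u :- p :* w) :+ β :* (v :+ s :* w) :+ (β :* β :- β :* s :+ p) :* w) refl β s p

    -- Positive definiteness gives y = z = 0. Now y = 0 says βu = w, and the irrationality of β
    -- forces u = w = 0.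
    conjugateNorm≈0⇒value≈0 : ∀ x → conjugateNorm x ≈ 0# → value x ≈ 0#
    conjugateNorm≈0⇒value≈0 ⟨ u , v , w ⟩ q≈0 = begin
      valueℝ U V W                                     ≈⟨ value-identity U V W ⟩
      (U - p * W) + β * (V + s * W) + δ * W            ≈⟨ +-cong (+-cong y≈0 (*-congˡ z≈0)) (*-congˡ W≈0) ⟩
      0# + β * 0# + δ * 0#
        ≈⟨ solve 2 (λ β δ → con 0ℤ :+ β :* con 0ℤ :+ δ :* con 0ℤ := con 0ℤ) refl β δ ⟩
      0#                                               ∎
      where
      U = fromℤ u
      V = fromℤ v
      W = fromℤ w
      sum≈0 : (fromℕ 2 * (U - p * W) + s * (V + s * W)) * (fromℕ 2 * (U - p * W) + s * (V + s * W))
                + (fromℕ 4 * p - s * s) * ((V + s * W) * (V + s * W)) ≈ 0#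
      sum≈0 = trans (sym (conjugateNormℝ-identity U V W)) (trans (*-congˡ q≈0) (zeroʳ _))
      z≈0 : V + s * W ≈ 0#
      z≈0 with excludedMiddle (V + s * W ≈ 0#)
      ... | yes p = p
      ... | no z≉0 = ⊥-elim (0<⇒≉0 (0<-+ (*-pos (<⇒0<difference s²<4p) (0<-square z≉0)) (0≤-square _))
        (trans (+-comm _ _) sum≈0))
      2y+sz≈0 : fromℕ 2 * (U - p * W) + s * (V + s * W) ≈ 0#
      2y+sz≈0 with excludedMiddle (fromℕ 2 * (U - p * W) + s * (V + s * W) ≈ 0#)
      ... | yes p = p
      ... | no ≉0 = ⊥-elim (0<⇒≉0 (0<-+ (0<-square ≉0)
        (0≤-* (inj₁ (<⇒0<difference s²<4p)) (0≤-square _))) sum≈0)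
      y≈0 : U - p * W ≈ 0#
      y≈0 = *-cancelˡ-≈ (0<⇒≉0 (0<-+ 0<1 (inj₁ 0<1)))
        (begin
          fromℕ 2 * (U - p * W)
            ≈⟨ trans (+-congˡ (trans (*-congˡ z≈0) (zeroʳ s))) (+-identityʳ _) ⟨
          fromℕ 2 * (U - p * W) + s * (V + s * W)      ≈⟨ 2y+sz≈0 ⟩
          0#                                           ≈⟨ zeroʳ _ ⟨
          fromℕ 2 * 0#                                 ∎)
      βU≈W : β * U ≈ W
      βU≈W = begin
        β * U
          ≈⟨ solve 4 (λ β p u w → β :* u := β :* (u :- p :* w) :+ β :* p :* w) refl β p U W ⟩
        β * (U - p * W) + β * p * W
          ≈⟨ +-cong (trans (*-congˡ y≈0) (zeroʳ β)) (trans (*-congʳ βp≈1) (*-identityˡ W)) ⟩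
        0# + W                                         ≈⟨ +-identityˡ W ⟩
        W                                              ∎
      W≈0 : W ≈ 0#
      W≈0 with excludedMiddle (u ≡ 0ℤ)
      ... | yes u≡0 = trans (sym βU≈W) (trans (*-congˡ (reflexive (≡.cong fromℤ u≡0))) (zeroʳ β))
      ... | no  u≢0 = ⊥-elim (β-irrational u≢0 w βU≈W)

    1≤norm : ∀ x → 0# < value x → 1# ≤ value x * conjugateNorm x
    1≤norm x 0<x with norm∈ℤ x
    ... | k , norm≈k = ≤-respʳ-≈ (sym norm≈k)
      (≤-respˡ-≈ fromℤ-1 (fromℤ-mono-≤ (ℤₚ.i<j⇒suc[i]≤j
      (fromℤ-cancel-< {0ℤ} {k} (<-respʳ-≈ norm≈k (*-pos 0<x 0<q))))))
      where
      0<q : 0# < conjugateNorm x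
      0<q with 0≤conjugateNorm x
      ... | inj₁ 0<q = 0<q
      ... | inj₂ 0≈q = ⊥-elim (0<⇒≉0 0<x (conjugateNorm≈0⇒value≈0 x (sym 0≈q)))

    -- Powers of β and their characteristic polynomials

    mulβ^ : ℕ → Triple → Triple
    mulβ^ zero    x = x
    mulβ^ (suc n) x = mulβ (mulβ^ n x)

    mulβ^-+ : ∀ m n x → mulβ^ (m ℕ.+ n) x ≡ mulβ^ m (mulβ^ n x)
    mulβ^-+ zero    n x = ≡.refl
    mulβ^-+ (suc m) n x = ≡.cong mulβ (mulβ^-+ m n x)

    mulβ^-isLinear : ∀ n → IsLinear (mulβ^ n)
    mulβ^-isLinear zero    = record { ⊕-homo = λ _ _ → ≡.refl ; ⊙-homo = λ _ _ → ≡.refl }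
    mulβ^-isLinear (suc n) = record
      { ⊕-homo = λ x y → ≡.trans (≡.cong mulβ (R.⊕-homo x y)) (L.⊕-homo (mulβ^ n x) (mulβ^ n y))
      ; ⊙-homo = λ k x → ≡.trans (≡.cong mulβ (R.⊙-homo k x)) (L.⊙-homo k (mulβ^ n x))
      }
      where
      module L = IsLinear mulβ-isLinear
      module R = IsLinear (mulβ^-isLinear n)

    value-mulβ^ : ∀ n x → value (mulβ^ n x) ≈ β ^ n * value x
    value-mulβ^ zero    x = sym (*-identityˡ _)
    value-mulβ^ (suc n) x = trans (value-mulβ (mulβ^ n x))
      (trans (*-congˡ (value-mulβ^ n x)) (sym (*-assoc _ _ _)))

    conjugateNorm-mulβ^ : ∀ n x → conjugateNorm (mulβ^ n x) ≈ p ^ n * conjugateNorm x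
    conjugateNorm-mulβ^ zero    x = sym (*-identityˡ _)
    conjugateNorm-mulβ^ (suc n) x = trans (conjugateNorm-mulβ (mulβ^ n x))
      (trans (*-congˡ (conjugateNorm-mulβ^ n x)) (sym (*-assoc _ _ _)))

    β^*p^≈1 : ∀ n → β ^ n * p ^ n ≈ 1#
    β^*p^≈1 zero    = *-identityˡ 1#
    β^*p^≈1 (suc n) = begin
      β * β ^ n * (p * p ^ n)
        ≈⟨ solve 4 (λ β x p y → β :* x :* (p :* y) := β :* p :* (x :* y)) refl β (β ^ n) p (p ^ n) ⟩
      β * p * (β ^ n * p ^ n)        ≈⟨ *-cong βp≈1 (β^*p^≈1 n) ⟩
      1# * 1#                        ≈⟨ *-identityˡ 1# ⟩
      1#                             ∎

    power : ℕ → Triple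
    power n = mulβ^ n ⟨ 1ℤ , 0ℤ , 0ℤ ⟩

    value-power : ∀ n → value (power n) ≈ β ^ n
    value-power n = begin
      value (power n)                           ≈⟨ value-mulβ^ n ⟨ 1ℤ , 0ℤ , 0ℤ ⟩ ⟩
      β ^ n * valueℝ (fromℤ 1ℤ) 0# 0#           ≈⟨ *-congˡ (valueℝ-cong fromℤ-1 refl refl) ⟩
      β ^ n * (1# + β * 0# + β * β * 0#)
        ≈⟨ solve 2 (λ x β → x :* (con 1ℤ :+ β :* con 0ℤ :+ β :* β :* con 0ℤ) := x) refl (β ^ n) β ⟩
      β ^ n                                     ∎

    conjugateNorm-power : ∀ n → conjugateNorm (power n) ≈ p ^ n
    conjugateNorm-power n = begin
      conjugateNorm (power n)                          ≈⟨ conjugateNorm-mulβ^ n ⟨ 1ℤ , 0ℤ , 0ℤ ⟩ ⟩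
      p ^ n * conjugateNormℝ (fromℤ 1ℤ) 0# 0#          ≈⟨ *-congˡ (conjugateNormℝ-cong fromℤ-1 refl refl) ⟩
      p ^ n * conjugateNormℝ 1# 0# 0#                  ≈⟨ solve 3 (λ x s p →
        x :* conjugateNormₚ s p (con 1ℤ) (con 0ℤ) (con 0ℤ) := x) refl (p ^ n) s p ⟩
      p ^ n                                            ∎

    -- X³ - tX² + nX - 1 is the polynomial of βˡ, and `S` is the sum of αˡ and its complex
    -- conjugate. The bound on `S` expresses |Re αˡ| ≤ |αˡ|; it is not strict because αˡ might be
    -- real.
    record CharacteristicPolynomial (l : ℕ) : Set where
      field
        S         : Carrier
        t n       : ℤ
        t≈        : fromℤ t ≈ β ^ l + S
        n≈        : fromℤ n ≈ β ^ l * S + p ^ l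
        S²≤4p^    : S * S ≤ fromℕ 4 * p ^ l
        relation  : ∀ x → mulβ^ l (mulβ^ l (mulβ^ l x)) ≡ t ⊙ mulβ^ l (mulβ^ l x) ⊝ n ⊙ mulβ^ l x ⊕ x

    initial : CharacteristicPolynomial 1
    initial = record
      { S        = s
      ; t        = a
      ; n        = ℤ.- b
      ; t≈       = trans a≈ (+-congʳ (sym (*-identityʳ β)))
      ; n≈       = trans (trans (fromℤ-neg b)
        (trans (-‿cong b≈) (solve 1 (λ x → :- (:- x) := x) refl (β * s + p))))
        (+-cong (*-congʳ (sym (*-identityʳ β))) (sym (*-identityʳ p)))
      ; S²≤4p^   = ≤-respʳ-≈ (*-congˡ (sym (*-identityʳ p))) (inj₁ s²<4p)
      ; relation = mulβ-relation
      }
    -- Graeffe's step, followed on the roots: S² - 2pˡ is the corresponding sum for α²ˡ. Starting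
    -- from `initial` this reaches the exponents 2ʲ, which suffices since the argument only asks for
    -- some large exponent.
    doubled : ∀ {l} → CharacteristicPolynomial l → CharacteristicPolynomial (l ℕ.+ l)
    doubled {l} record { S = S ; t = t ; n = n ; t≈ = t≈ ; n≈ = n≈ ; S²≤4p^ = S²≤4p^ ; relation = relation } = record
      { S        = S * S - fromℕ 2 * P
      ; t        = t ℤ.* t ℤ.- + 2 ℤ.* n
      ; n        = n ℤ.* n ℤ.- + 2 ℤ.* t
      ; t≈       = begin
          fromℤ (t ℤ.* t ℤ.- + 2 ℤ.* n)                                    ≈⟨ square-2* t n t≈ n≈ ⟩
          (θ + S) * (θ + S) - fromℕ 2 * (θ * S + P)
            ≈⟨ solve 3 (λ θ S P → (θ :+ S) :* (θ :+ S) :- con (+ 2) :* (θ :* S :+ P)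
              := θ :* θ :+ (S :* S :- con (+ 2) :* P)) refl θ S P ⟩
          θ * θ + (S * S - fromℕ 2 * P)                                    ≈⟨ +-congʳ (^-homo-* β l l) ⟨
          β ^ (l ℕ.+ l) + (S * S - fromℕ 2 * P)                            ∎
      ; n≈       = begin
          fromℤ (n ℤ.* n ℤ.- + 2 ℤ.* t)                                    ≈⟨ square-2* n t n≈ t≈ ⟩
          (θ * S + P) * (θ * S + P) - fromℕ 2 * (θ + S)
            ≈⟨ solve 3 (λ θ S P → (θ :* S :+ P) :* (θ :* S :+ P) :- con (+ 2) :* (θ :+ S)
              := θ :* θ :* (S :* S)
              :+ P :* P :- con (+ 2) :* θ :* con 1ℤ :+ con (+ 2) :* (θ :* P :- con 1ℤ) :* S) refl θ S P ⟩
          θ * θ * (S * S) + P * P - fromℕ 2 * θ * 1# + fromℕ 2 * (θ * P - 1#) * S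
              ≈⟨ +-cong (+-congˡ
              (-‿cong (*-congˡ (sym θP≈1))))
              (*-congʳ (*-congˡ
              (+-congʳ θP≈1))) ⟩
          θ * θ * (S * S) + P * P - fromℕ 2 * θ * (θ * P) + fromℕ 2 * (1# - 1#) * S
              ≈⟨ solve 3 (λ θ S P
              → θ :* θ :* (S :* S)
              :+ P :* P :- con (+ 2) :* θ :* (θ :* P) :+ con (+ 2) :* (con 1ℤ :- con 1ℤ) :* S
              := θ :* θ :* (S :* S :- con (+ 2) :* P) :+ P :* P) refl θ S P ⟩
          θ * θ * (S * S - fromℕ 2 * P) + P * P
            ≈⟨ +-cong (*-congʳ (^-homo-* β l l)) (^-homo-* p l l) ⟨
          β ^ (l ℕ.+ l) * (S * S - fromℕ 2 * P) + p ^ (l ℕ.+ l)            ∎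
      ; S²≤4p^   = ≤-respʳ-≈ (*-congˡ (sym (^-homo-* p l l))) (≤-fromDifference
          (solve 2 (λ S P → S :* S :* (con (+ 4) :* P :- S :* S)
             := con (+ 4) :* (P :* P) :- (S :* S :- con (+ 2) :* P) :* (S :* S :- con (+ 2) :* P)) refl S P)
          (0≤-* (0≤-square S) (≤⇒0≤difference S²≤4p^)))
      ; relation = λ x → relation′ x
      }
      where
      θ = β ^ l
      P = p ^ l
      T = mulβ^ l
      θP≈1 : θ * P ≈ 1#
      θP≈1 = β^*p^≈1 l
      square-2* : ∀ i j {x y} → fromℤ i ≈ x → fromℤ j ≈ y → fromℤ (i ℤ.* i ℤ.- + 2 ℤ.* j)
        ≈ x * x - fromℕ 2 * y
      square-2* i j i≈x j≈y = trans (fromℤ-difference (+ 2 ℤ.* j) (i ℤ.* i))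
        (+-cong (trans (fromℤ-* i i) (*-cong i≈x i≈x))
          (-‿cong (trans (fromℤ-* (+ 2) j) (*-cong (fromℕ≈ 2) j≈y))))
      relation′ : ∀ x → mulβ^ (l ℕ.+ l) (mulβ^ (l ℕ.+ l) (mulβ^ (l ℕ.+ l) x)) ≡
        (t ℤ.* t ℤ.- + 2 ℤ.* n) ⊙ mulβ^ (l ℕ.+ l)
          (mulβ^ (l ℕ.+ l) x) ⊝ (n ℤ.* n ℤ.- + 2 ℤ.* t) ⊙ mulβ^ (l ℕ.+ l) x ⊕ x
      relation′ x rewrite mulβ^-+ l l x | mulβ^-+ l l (T (T x)) | mulβ^-+ l l (T (T (T (T x)))) =
        squared-relation {T} {t} {n} relation x

    module _ {l : ℕ} (1<β^l : 1# < β ^ l) (char : CharacteristicPolynomial l) where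
      open CharacteristicPolynomial char

      -- t - n is minus the value of the characteristic polynomial at 1, hence the norm of βˡ - 1.
      -- It factors as (βˡ - 1)(1 - S + P), and the second factor |1 - αˡ|² is positive because S² ≤
      -- 4P < (1 + P)².
      norm-positive : 0ℤ ℤ.< t ℤ.- n
      norm-positive = fromℤ-cancel-< {0ℤ}
        (<-respʳ-≈ (sym norm≈) (*-pos (<⇒0<difference 1<β^l) (<-respʳ-≈ rearrange (<⇒0<difference S<1+P))))
        where
        θ = β ^ l
        P = p ^ l
        θP≈1 : θ * P ≈ 1#
        θP≈1 = β^*p^≈1 l
        0<θ : 0# < θ
        0<θ = 0<β^ l
        0<P : 0# < P
        0<P = *-cancelˡ-< 0<θ (<-respˡ-≈ (sym (zeroʳ θ)) (<-respʳ-≈ (sym θP≈1) 0<1))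
        P<1 : P < 1#
        P<1 = *-cancelˡ-< 0<θ (<-respˡ-≈ (sym θP≈1) (<-respʳ-≈ (sym (*-identityʳ θ)) 1<β^l))
        S<1+P : S < 1# + P
        S<1+P = square-cancel-< (0<-+ 0<1 (inj₁ 0<P)) (≤-<-trans S²≤4p^ (<-fromDifference
          (solve 1 (λ P → (con 1ℤ :- P) :* (con 1ℤ :- P) := (con 1ℤ :+ P) :* (con 1ℤ :+ P) :- con (+ 4) :* P)
            refl P)
          (*-pos (<⇒0<difference P<1) (<⇒0<difference P<1))))
        rearrange : 1# + P - S ≈ 1# - S + P
        rearrange = solve 2 (λ P S → con 1ℤ :+ P :- S := con 1ℤ :- S :+ P) refl P S
        norm≈ : fromℤ (t ℤ.- n) ≈ (θ - 1#) * (1# - S + P)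
        norm≈ = begin
          fromℤ (t ℤ.- n)
            ≈⟨ trans (fromℤ-difference n t) (+-cong t≈ (-‿cong n≈)) ⟩
          (θ + S) - (θ * S + P)
            ≈⟨ solve 3 (λ θ S P → (θ :+ S) :- (θ :* S :+ P)
              := (θ :- con 1ℤ) :* (con 1ℤ :- S :+ P) :- (θ :* P :- con 1ℤ)) refl θ S P ⟩
          (θ - 1#) * (1# - S + P) - (θ * P - 1#)             ≈⟨ +-congˡ (-‿cong (+-congʳ θP≈1)) ⟩
          (θ - 1#) * (1# - S + P) - (1# - 1#)
            ≈⟨ solve 1 (λ x → x :- (con 1ℤ :- con 1ℤ) := x) refl _ ⟩
          (θ - 1#) * (1# - S + P)                            ∎

    large-exponent : ∀ x → ∃[ k ] x < β ^ k × CharacteristicPolynomial k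
    large-exponent x = helper (^-unbounded x)
      where
      2^ : ℕ → ℕ
      2^ zero    = 1
      2^ (suc n) = 2^ n ℕ.+ 2^ n
      n<2^ : ∀ n → n ℕ.< 2^ n
      n<2^ zero    = ℕₚ.n<1+n 0
      n<2^ (suc n) = ℕₚ.+-mono-≤ (ℕₚ.≤-trans (ℕ.s≤s ℕ.z≤n) (n<2^ n)) (n<2^ n)
      n≤2^ : ∀ n → n ℕ.≤ 2^ n
      n≤2^ n = ℕₚ.<⇒≤ (n<2^ n)
      characteristic : ∀ n → CharacteristicPolynomial (2^ n)
      characteristic zero    = initial
      characteristic (suc n) = doubled (characteristic n)
      helper : ∃[ n ] x < β ^ n → ∃[ k ] x < β ^ k × CharacteristicPolynomial k
      helper (n , x<β^n) = 2^ n , <-≤-trans x<β^n (^-mono-≤ (n≤2^ n)) , characteristic n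

    -- Separation of units congruent to powers of β

    private
      -- The real estimate behind `close-absurd`. `U` and `V` are the values of two units of norm 1
      -- and `q₁`, `q₂` their conjugate norms; `d` is the conjugate norm of their difference (βˡ -
      -- 1)y, while `Y` and `q` belong to y. Then (B - 1)(1 - 2c) ≤ (U - V)(1 - 2c)q ≤ 2(U - V)d ≤
      -- 4C, but the left-hand side is B - 3 + 2c > 4C.
      gap-absurd : ∀ {U V B C Y c q q₁ q₂ d} → fromℕ 5 < C → B ≈ C * C → B * c ≈ 1# → 0# ≤ c →
        0# < V → V < U → U ≤ C * V → U - V ≈ (B - 1#) * Y → 1# ≤ Y * q →
        q ≤ fromℕ 2 * (c * q + d) → d ≤ fromℕ 2 * (q₁ + q₂) → 0# ≤ q₁ → 0# ≤ q₂ → U * q₁ ≈ 1# → V * q₂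
          ≈ 1# → ⊥
      gap-absurd {U} {V} {B} {C} {Y} {c} {q} {q₁} {q₂} {d} 5<C B≈ Bc≈1 0≤c 0<V V<U U≤CV U-V≈ 1≤Yq q≤ d≤ 0≤q₁ 0≤q₂ Uq₁≈1 Vq₂≈1 =
        ≤⇒≯ (≤-trans lower (≤-trans middle upper)) strict
        where
        k : Carrier
        k = 1# - fromℕ 2 * c
        0≤U-V : 0# ≤ U - V
        0≤U-V = ≤⇒0≤difference (inj₁ V<U)
        0<C : 0# < C
        0<C = ≤-<-trans (0≤-fromℕ 5) 5<C
        -- Origin of the constant 5: what is needed is C² > 4C + 3, whose exact threshold 2 + √7 is
        -- replaced by the next integer.
        strict′ : fromℕ 2 + (C - fromℕ 5) * (C + 1#) ≈ C * C - (fromℕ 4 * C + fromℕ 3)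
        strict′ = solve 1 (λ C → con (+ 2) :+ (C :- con (+ 5)) :* (C :+ con 1ℤ)
          := C :* C :- (con (+ 4) :* C :+ con (+ 3))) refl C
        4C+3<B : fromℕ 4 * C + fromℕ 3 < B
        4C+3<B = <-respʳ-≈ (sym B≈) (<-fromDifference strict′
          (0<-+ (0<-+ 0<1 (inj₁ 0<1)) (inj₁ (*-pos (<⇒0<difference 5<C) (0<-+ 0<C (inj₁ 0<1))))))
        2≤B : fromℕ 2 ≤ B
        2≤B = inj₁ (<-trans (<-fromDifference
          (solve 1 (λ C → con (+ 4) :* C :+ con 1ℤ := con (+ 4) :* C :+ con (+ 3) :- con (+ 2)) refl C)
          (<-respʳ-≈ (+-comm _ _) (0<-+ 0<1 (0≤-* (0≤-fromℕ 4) (inj₁ 0<C))))) 4C+3<B)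
        0≤B-1 : 0# ≤ B - 1#
        0≤B-1 = ≤⇒0≤difference (≤-trans (inj₁
          (<-fromDifference (solve 0 (con 1ℤ := con (+ 2) :- con 1ℤ) refl) 0<1)) 2≤B)
        0≤k : 0# ≤ k
        0≤k = ≤⇒0≤difference (≤-respˡ-≈ (*-comm c _)
          (≤-respʳ-≈ (trans (*-comm c B) Bc≈1) (*-monoˡ-≤ 0≤c 2≤B)))
        lower : (B - 1#) * k ≤ (B - 1#) * k * (Y * q)
        lower = ≤-respˡ-≈ (*-identityʳ _) (*-monoˡ-≤ (0≤-* 0≤B-1 0≤k) 1≤Yq)
        middle : (B - 1#) * k * (Y * q) ≤ fromℕ 2 * ((U - V) * d)
        middle = ≤-fromDifference
          (begin
            (U - V) * (fromℕ 2 * (c * q + d) - q)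
              ≈⟨ solve 4 (λ x c q d → x :* (con (+ 2) :* (c :* q :+ d) :- q)
                := con (+ 2) :* (x :* d) :- x :* (con 1ℤ :- con (+ 2) :* c) :* q) refl (U - V) c q d ⟩
            fromℕ 2 * ((U - V) * d) - (U - V) * k * q
              ≈⟨ +-congˡ (-‿cong (*-congʳ (*-congʳ U-V≈))) ⟩
            fromℕ 2 * ((U - V) * d) - (B - 1#) * Y * k * q
              ≈⟨ +-congˡ (-‿cong (solve 4 (λ x y k q → x :* y :* k :* q := x :* k :* (y :* q))
                refl (B - 1#) Y k q)) ⟩
            fromℕ 2 * ((U - V) * d) - (B - 1#) * k * (Y * q)               ∎)
          (0≤-* 0≤U-V (≤⇒0≤difference q≤))
        -- As Uq₁ = Vq₂ = 1, the product (U - V)(q₁ + q₂) collapses to Uq₂ - Vq₁, and Uq₂ ≤ CVq₂ =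
        -- C.
        upper : fromℕ 2 * ((U - V) * d) ≤ fromℕ 4 * C
        upper = ≤-trans (*-monoˡ-≤ (0≤-fromℕ 2) (*-monoˡ-≤ 0≤U-V d≤)) (≤-fromDifference
          (begin
            fromℕ 4 * (V * q₁) + fromℕ 4 * (q₂ * (C * V - U))
              ≈⟨ solve 5 (λ U V q₁ q₂ C → con (+ 4) :* (V :* q₁) :+ con (+ 4) :* (q₂ :* (C :* V :- U))
                   := con (+ 4) :* C :* (V :* q₂)
                     :+ con (+ 4) :* (U :* q₁ :- V :* q₂) :- con (+ 2) :* ((U :- V) :* (con (+ 2) :* (q₁
                     :+ q₂)))) refl U V q₁ q₂ C ⟩
            fromℕ 4 * C * (V * q₂) + fromℕ 4 * (U * q₁ - V * q₂) - fromℕ 2 * ((U - V) * (fromℕ 2 * (q₁ + q₂)))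
              ≈⟨ +-congʳ (+-cong (*-congˡ Vq₂≈1) (*-congˡ (+-cong Uq₁≈1 (-‿cong Vq₂≈1)))) ⟩
            fromℕ 4 * C * 1# + fromℕ 4 * (1# - 1#) - fromℕ 2 * ((U - V) * (fromℕ 2 * (q₁ + q₂)))
              ≈⟨ +-congʳ (solve 1 (λ C → con (+ 4) :* C :* con 1ℤ :+ con (+ 4) :* (con 1ℤ :- con 1ℤ)
                := con (+ 4) :* C) refl C) ⟩
            fromℕ 4 * C - fromℕ 2 * ((U - V) * (fromℕ 2 * (q₁ + q₂)))
              ∎)
          (0≤-+ (0≤-* (0≤-fromℕ 4) (0≤-* (inj₁ 0<V) 0≤q₁))
            (0≤-* (0≤-fromℕ 4) (0≤-* 0≤q₂ (≤⇒0≤difference U≤CV)))))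
        strict : fromℕ 4 * C < (B - 1#) * k
        strict = <-fromDifference
          (begin
            (B - (fromℕ 4 * C + fromℕ 3)) + fromℕ 2 * c
              ≈⟨ solve 3 (λ B C c → (B :- (con (+ 4) :* C :+ con (+ 3))) :+ con (+ 2) :* c
              := (B :- con 1ℤ) :* (con 1ℤ :- con (+ 2) :* c) :- con (+ 4) :* C :+ con (+ 2) :* (B :* c :- con 1ℤ)) refl B C c ⟩
            (B - 1#) * k - fromℕ 4 * C + fromℕ 2 * (B * c - 1#)
              ≈⟨ +-congˡ (*-congˡ (+-congʳ Bc≈1)) ⟩
            (B - 1#) * k - fromℕ 4 * C + fromℕ 2 * (1# - 1#)
              ≈⟨ solve 1 (λ x → x :+ con (+ 2) :* (con 1ℤ :- con 1ℤ) := x) refl ((B - 1#) * k - fromℕ 4 * C) ⟩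
            (B - 1#) * k - fromℕ 4 * C                                     ∎)
          (0<-+ (<⇒0<difference 4C+3<B) (0≤-* (0≤-fromℕ 2) 0≤c))

    0<p^ : ∀ n → 0# < p ^ n
    0<p^ zero    = 0<1
    0<p^ (suc n) = *-pos 0<p (0<p^ n)

    module Separation (k : ℕ) (5<β^k : fromℕ 5 < β ^ k) (char : CharacteristicPolynomial (k ℕ.+ k)) where

      l = k ℕ.+ k

      private
        C = β ^ k

      1<β^k : 1# < C
      1<β^k = <-trans (<-fromDifference (solve 0 (con (+ 4) := con (+ 5) :- con 1ℤ) refl) (0<-fromℕ 3)) 5<β^k

      1<β^l : 1# < β ^ l
      1<β^l = <-respʳ-≈ (sym (^-homo-* β k k))
        (<-trans 1<β^k (<-respˡ-≈ (*-identityʳ C) (*-monoˡ-< (0<β^ k) 1<β^k)))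

      open CharacteristicPolynomial char
      open Congruence (mulβ^-isLinear l)

      -- The larger element comes first. The unit under examination and the power of β compared with
      -- it will occur in either role.
      close-absurd : ∀ {x e} → x ≋ e [mod mulβ^ l ] → 0# < value e → value e < value x → value x
        ≤ C * value e →
                     value x * conjugateNorm x ≈ 1# → value e * conjugateNorm e ≈ 1# → ⊥
      close-absurd {x} {e} (y , ≡.refl) 0<e e<x x≤Ce norm-x norm-e =
        gap-absurd {Y = value y} {q = conjugateNorm y} 5<β^k (^-homo-* β k k) (β^*p^≈1 l)
          (inj₁ (0<p^ l)) 0<e e<x x≤Ce difference
          (1≤norm y 0<y) q≤ d≤ (0≤conjugateNorm x) (0≤conjugateNorm e) norm-x norm-e
        where
        T = mulβ^ l
        d = T y ⊝ y
        ⊕-cancel : ∀ e d → (e ⊕ d) ⊝ e ≡ d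
        ⊕-cancel ⟨ a , b , c ⟩ ⟨ d , e , f ⟩ = triple-≡ (identity a d) (identity b e) (identity c f)
          where
          identity = ℤ-solve 2 (λ i j → i ⊞ j ⊟ i ⩵ j) ≡.refl
        ⊝-cancel : ∀ x y → x ⊝ (x ⊝ y) ≡ y
        ⊝-cancel ⟨ a , b , c ⟩ ⟨ d , e , f ⟩ = triple-≡ (identity a d) (identity b e) (identity c f)
          where
          identity = ℤ-solve 2 (λ i j → i ⊟ (i ⊟ j) ⩵ j) ≡.refl
        difference : value (e ⊕ d) - value e ≈ (β ^ l - 1#) * value y
        difference = begin
          value (e ⊕ d) - value e
            ≈⟨ +-congʳ (trans (value-⊕ e d) (+-congˡ (trans (value-⊝ (T y) y) (+-congʳ (value-mulβ^ l y))))) ⟩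
          value e + (β ^ l * value y - value y) - value e
              ≈⟨ solve 3 (λ e B Y → e :+ (B :* Y :- Y) :- e
              := (B :- con 1ℤ) :* Y)
              refl (value e) (β ^ l) (value y) ⟩
          (β ^ l - 1#) * value y                        ∎
        0<y : 0# < value y
        0<y = *-cancelˡ-< (<⇒0<difference 1<β^l)
          (<-respˡ-≈ (sym (zeroʳ _)) (<-respʳ-≈ difference (<⇒0<difference e<x)))
        -- Here y is written as βˡy - (βˡy - y); the conjugate norm of the first term is smaller
        -- than that of y by the factor pˡ.
        q≤ : conjugateNorm y ≤ fromℕ 2 * (p ^ l * conjugateNorm y + conjugateNorm d)
        q≤ = ≤-respʳ-≈ (*-congˡ (+-congʳ (conjugateNorm-mulβ^ l y)))
          (≡.subst (λ z → conjugateNorm z ≤ fromℕ 2 * (conjugateNorm (T y) + conjugateNorm d))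
            (⊝-cancel (T y) y) (conjugateNorm-⊝-≤ (T y) d))
        d≤ : conjugateNorm d ≤ fromℕ 2 * (conjugateNorm (e ⊕ d) + conjugateNorm e)
        d≤ = ≡.subst (λ z → conjugateNorm z ≤ fromℕ 2 * (conjugateNorm (e ⊕ d) + conjugateNorm e))
          (⊕-cancel e d) (conjugateNorm-⊝-≤ (e ⊕ d) e)

      1≤l : 1 ℕ.≤ l
      1≤l = ℕₚ.n≢0⇒n>0 λ l≡0 → <-irr (<-respʳ-≈ (reflexive (≡.cong (β ^_) l≡0)) 1<β^l)

      -- As βˡ ≡ 1, the exponents i < l represent all classes of powers. The bound also puts βⁱ
      -- below βˡ = C², hence below Cx as soon as C < x, and this is where the search for the right
      -- power starts.
      PowerClass : Triple → Set
      PowerClass x = ∃[ i ] i ℕ.< l × x ≋ power i [mod mulβ^ l ]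

      power-≋ : ∀ j i → power (j ℕ.* l ℕ.+ i) ≋ power i [mod mulβ^ l ]
      power-≋ zero    i = mod-refl (power i)
      power-≋ (suc j) i = mod-trans
        (≡.subst (_≋ power (j ℕ.* l ℕ.+ i) [mod mulβ^ l ])
          (≡.trans (≡.sym (mulβ^-+ l (j ℕ.* l ℕ.+ i) _)) (≡.cong power (≡.sym (ℕₚ.+-assoc l (j ℕ.* l) i))))
          (T-mod (power (j ℕ.* l ℕ.+ i))))
        (power-≋ j i)

      power-PowerClass : ∀ n → PowerClass (power n)
      power-PowerClass n = n ℕ-DivMod.% l , ℕ-DivMod.m%n<n n l ,
        ≡.subst (λ m → power m ≋ power (n ℕ-DivMod.% l) [mod mulβ^ l ])
          (≡.sym (≡.trans (ℕ-DivMod.m≡m%n+[m/n]*n n l) (ℕₚ.+-comm (n ℕ-DivMod.% l) _)))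
          (power-≋ (n ℕ-DivMod./ l) (n ℕ-DivMod.% l))
        where
        instance
          l≢0 : ℕ.NonZero l
          l≢0 = ℕ.>-nonZero 1≤l

      PowerClass-norm : ∀ x z → PowerClass (x ⊕ (t ℤ.- n) ⊙ z) → PowerClass x
      PowerClass-norm x z (i , i<l , x+Nz≋) = i , i<l , mod-trans (mod-sym (norm-mod relation x z)) x+Nz≋

      -- The candidates `f j` form a progression of ratio C². The last one not exceeding Cx is
      -- therefore larger than x/C, and `close-absurd` excludes that it differs from x in either
      -- direction.
      PowerClass⇒power : ∀ x → PowerClass x → value x * conjugateNorm x ≈ 1# → C < value x → ∃[ n ] value x
        ≈ β ^ n
      PowerClass⇒power x (i , i<l , x≋) norm-x C<x =
        helper (^-unbounded (C * value x))
        where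
        f : ℕ → Carrier
        f j = β ^ (j ℕ.* l ℕ.+ i)
        f0≤ : f 0 ≤ C * value x
        f0≤ = ≤-trans (^-mono-≤ (ℕₚ.<⇒≤ i<l))
          (≤-respˡ-≈ (sym (^-homo-* β k k)) (*-monoˡ-≤ (inj₁ (0<β^ k)) (inj₁ C<x)))
        f-suc : ∀ j → f (suc j) ≈ C * (C * f j)
        f-suc j = begin
          β ^ (l ℕ.+ j ℕ.* l ℕ.+ i)       ≡⟨ ≡.cong (β ^_) (ℕₚ.+-assoc l (j ℕ.* l) i) ⟩
          β ^ (l ℕ.+ (j ℕ.* l ℕ.+ i))     ≈⟨ ^-homo-* β l (j ℕ.* l ℕ.+ i) ⟩
          β ^ l * f j                     ≈⟨ *-congʳ (^-homo-* β k k) ⟩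
          C * C * f j                     ≈⟨ *-assoc _ _ _ ⟩
          C * (C * f j)                   ∎
        n≤nl+i : ∀ n → n ℕ.≤ n ℕ.* l ℕ.+ i
        n≤nl+i n = ℕₚ.≤-trans (ℕₚ.m≤m*n n l {{ℕ.>-nonZero 1≤l}}) (ℕₚ.m≤m+n (n ℕ.* l) i)
        compared : ∀ j → f j ≤ C * value x → C * value x < f (suc j) → value x ≈ f j
        compared j fj≤Cx Cx<fsj with compare (value x) (f j)
        ... | tri≈ _ x≈fj _ = x≈fj
        ... | tri> _ _ fj<x = ⊥-elim (close-absurd {x} {e} x≋e
                (<-respʳ-≈ (sym value-e) (0<β^ (j ℕ.* l ℕ.+ i))) (<-respˡ-≈ (sym value-e) fj<x)
                (inj₁ (<-respʳ-≈ (*-congˡ (sym value-e))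
                  (*-cancelˡ-< (0<β^ k) (<-respʳ-≈ (f-suc j) Cx<fsj)))) norm-x norm-e)
          where
          e = power (j ℕ.* l ℕ.+ i)
          value-e = value-power (j ℕ.* l ℕ.+ i)
          x≋e = mod-trans x≋ (mod-sym (power-≋ j i))
          norm-e = trans (*-cong value-e (conjugateNorm-power (j ℕ.* l ℕ.+ i))) (β^*p^≈1 (j ℕ.* l ℕ.+ i))
        ... | tri< x<fj _ _ = ⊥-elim (close-absurd {e} {x} (mod-sym x≋e)
                (<-trans (0<β^ k) C<x) (<-respʳ-≈ (sym value-e) x<fj)
                  (≤-respˡ-≈ (sym value-e) fj≤Cx) norm-e norm-x)
          where
          e = power (j ℕ.* l ℕ.+ i)
          value-e = value-power (j ℕ.* l ℕ.+ i)
          x≋e = mod-trans x≋ (mod-sym (power-≋ j i))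
          norm-e = trans (*-cong value-e (conjugateNorm-power (j ℕ.* l ℕ.+ i))) (β^*p^≈1 (j ℕ.* l ℕ.+ i))
        found : ∃[ j ] f j ≤ C * value x × C * value x < f (suc j) → ∃[ n ] value x ≈ β ^ n
        found (j , fj≤Cx , Cx<fsj) = j ℕ.* l ℕ.+ i , compared j fj≤Cx Cx<fsj
        helper : ∃[ n ] C * value x < β ^ n → ∃[ n ] value x ≈ β ^ n
        helper (n , Cx<β^n) = found (bracket f f0≤ n (<-≤-trans Cx<β^n (^-mono-≤ (n≤nl+i n))))

      -- By `PowerClass-norm` the condition is periodic in each coordinate with period N = t - n.
      -- The coordinates are replaced by residues one after the other, until the condition on the
      -- fixed triple is constant.
      set-PowerClass : ∀ {u v w : ℤ → ℤ} → GeneralisedPolynomial (λ m → fromℤ (u m)) →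
        GeneralisedPolynomial (λ m → fromℤ (v m)) → GeneralisedPolynomial (λ m → fromℤ (w m)) →
        GeneralisedPolynomialSet (λ m → PowerClass ⟨ u m , v m , w m ⟩)
      -- The norm is generalised to a variable so that matching exhibits it as a non-zero natural
      -- number; positivity excludes the other cases.
      set-PowerClass {u} {v} {w} U V W = helper (t ℤ.- n) ≡.refl (norm-positive 1<β^l char)
        where
        helper : ∀ N → t ℤ.- n ≡ N → 0ℤ ℤ.< N → GeneralisedPolynomialSet
          (λ m → PowerClass ⟨ u m , v m , w m ⟩)
        helper (+ suc N) norm≡N _ =
          set-periodic β-irrational (suc N) {P = λ r m → PowerClass ⟨ u m , v m , r ⟩}
            (λ r₃ → set-periodic β-irrational (suc N) {P = λ r m → PowerClass ⟨ u m , r , r₃ ⟩}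
              (λ r₂ → set-periodic β-irrational (suc N) {P = λ r m → PowerClass ⟨ r , r₂ , r₃ ⟩}
                (λ r₁ → set-constant _)
                (λ r z m → shift ⟨ r , r₂ , r₃ ⟩ ⟨ z , 0ℤ , 0ℤ ⟩
                  (triple-≡ ≡.refl (ℤₚ.+-identityʳ r₂) (ℤₚ.+-identityʳ r₃))) U)
              (λ r z m → shift ⟨ u m , r , r₃ ⟩ ⟨ 0ℤ , z , 0ℤ ⟩
                (triple-≡ (ℤₚ.+-identityʳ (u m)) ≡.refl (ℤₚ.+-identityʳ r₃))) V)
            (λ r z m → shift ⟨ u m , v m , r ⟩ ⟨ 0ℤ , 0ℤ , z ⟩
              (triple-≡ (ℤₚ.+-identityʳ (u m)) (ℤₚ.+-identityʳ (v m)) ≡.refl)) W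
          where
          _⊙ʳ_ : Triple → ℤ → Triple
          ⟨ x , y , z ⟩ ⊙ʳ k = ⟨ x ℤ.* k , y ℤ.* k , z ℤ.* k ⟩
          ⊙-comm : ∀ k x → k ⊙ x ≡ x ⊙ʳ k
          ⊙-comm k ⟨ x , y , z ⟩ = triple-≡ (ℤₚ.*-comm k x) (ℤₚ.*-comm k y) (ℤₚ.*-comm k z)
          shift : ∀ x z {x′} → x ⊕ z ⊙ʳ (+ suc N) ≡ x′ → PowerClass x′ → PowerClass x
          shift x z ≡.refl class = PowerClass-norm x z
            (≡.subst PowerClass (≡.cong (x ⊕_)
              (≡.trans (≡.sym (⊙-comm (+ suc N) z)) (≡.cong (_⊙ z) (≡.sym norm≡N)))) class)
        helper (+ zero) _ (ℤ.+<+ ())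
        helper -[1+ _ ] _ ()

    -- Recovering the coordinates of a large power from its trace

    private
      Small : Pred Carrier 0ℓ
      Small x = - ½ < x × x < ½

      2*½≈1 : fromℕ 2 * ½ ≈ 1#
      2*½≈1 = *-inverseʳ (1# + 1#) (0<⇒≉0 (0<-+ 0<1 (inj₁ 0<1)))

      4x²<1⇒small : ∀ {x} → fromℕ 4 * (x * x) < 1# → Small x
      4x²<1⇒small {x} 4x²<1 =
        <-fromDifference (solve 2 (λ h x → h :- :- x := x :- :- h) refl ½ x)
          (<⇒0<difference (bound (- x) (<-respˡ-≈
          (*-congˡ (solve 1 (λ x → x :* x := (:- x) :* (:- x)) refl x)) 4x²<1))) ,
        bound x 4x²<1
        where
        bound : ∀ y → fromℕ 4 * (y * y) < 1# → y < ½
        bound y 4y²<1 = *-cancelˡ-< (0<-+ 0<1 (inj₁ 0<1)) (<-respʳ-≈ (sym 2*½≈1)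
          (square-cancel-< 0<1 (<-respˡ-≈
            (solve 1 (λ y → con (+ 4) :* (y :* y) := con (+ 2) :* y :* (con (+ 2) :* y)) refl y)
            (<-respʳ-≈ (sym (*-identityˡ 1#)) 4y²<1))))

      D : Carrier
      D = fromℕ 4 * p - s * s

      0<D : 0# < D
      0<D = <⇒0<difference s²<4p

    -- y + zα is the image u + vα + wα² of a triple under a complex embedding.
    conjugate₀ conjugate₁ : Triple → Carrier
    conjugate₀ ⟨ u , v , w ⟩ = fromℤ u - p * fromℤ w
    conjugate₁ ⟨ u , v , w ⟩ = fromℤ v + s * fromℤ w

    conjugateNorm-conjugate : ∀ x → conjugateNorm x ≈
      conjugate₀ x * conjugate₀ x + s * conjugate₀ x * conjugate₁ x + p * (conjugate₁ x * conjugate₁ x)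
    conjugateNorm-conjugate ⟨ u , v , w ⟩ = solve 5 (λ s p u v w →
      conjugateNormₚ s p u v w
      := (u :- p :* w) :* (u :- p :* w) :+ s :* (u :- p :* w) :* (v :+ s :* w)
        :+ p :* ((v :+ s :* w) :* (v :+ s :* w)))
      refl s p (fromℤ u) (fromℤ v) (fromℤ w)

    -- With Q = y² + syz + pz² one has 4pQ - Dy² = (sy + 2pz)² and 4Q - Dz² = (2y + sz)², so Dy² ≤
    -- 4pQ and Dz² ≤ 4Q. The rest is (A + B)² ≤ 2A² + 2B².
    linearForm-bound : ∀ c₀ c₁ x →
      D * ((c₀ * conjugate₀ x + c₁ * conjugate₁ x) * (c₀ * conjugate₀ x + c₁ * conjugate₁ x)) ≤
      fromℕ 8 * (c₀ * c₀ * p + c₁ * c₁) * conjugateNorm x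
    linearForm-bound c₀ c₁ x = ≤-respʳ-≈ (*-congˡ (sym (conjugateNorm-conjugate x)))
      (bound (conjugate₀ x) (conjugate₁ x))
      where
      bound : ∀ y z → D * ((c₀ * y + c₁ * z) * (c₀ * y + c₁ * z)) ≤
                      fromℕ 8 * (c₀ * c₀ * p + c₁ * c₁) * (y * y + s * y * z + p * (z * z))
      bound y z = ≤-fromDifference
        (solve 6 (λ c₀ c₁ s p y z →
          (con (+ 4) :* p :- s :* s) :* ((c₀ :* y :- c₁ :* z) :* (c₀ :* y :- c₁ :* z))
            :+ (con (+ 2) :* (c₀ :* c₀ :* ((s :* y :+ con (+ 2) :* p :* z) :* (s :* y
              :+ con (+ 2) :* p :* z)))
               :+ con (+ 2) :* (c₁ :* c₁ :* ((con (+ 2) :* y :+ s :* z) :* (con (+ 2) :* y :+ s :* z))))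
          := con (+ 8) :* (c₀ :* c₀ :* p :+ c₁ :* c₁) :* (y :* y :+ s :* y :* z :+ p :* (z :* z))
             :- (con (+ 4) :* p :- s :* s) :* ((c₀ :* y :+ c₁ :* z) :* (c₀ :* y :+ c₁ :* z)))
               refl c₀ c₁ s p y z)
        (0≤-+ (0≤-* (inj₁ 0<D) (0≤-square _))
          (0≤-+ (0≤-* (0≤-fromℕ 2) (0≤-* (0≤-square c₀) (0≤-square _)))
            (0≤-* (0≤-fromℕ 2) (0≤-* (0≤-square c₁) (0≤-square _)))))

    Eventually : Pred ℕ 0ℓ → Set
    Eventually P = ∃[ n₀ ] ∀ n → n₀ ℕ.≤ n → P n

    eventually-× : ∀ {P Q : Pred ℕ 0ℓ} → Eventually P → Eventually Q → Eventually (λ n → P n × Q n)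
    eventually-× (m , P) (n , Q) =
      m ℕ.⊔ n , λ k m⊔n≤k → P k (ℕₚ.≤-trans (ℕₚ.m≤m⊔n m n) m⊔n≤k) , Q k (ℕₚ.≤-trans (ℕₚ.m≤n⊔m m n) m⊔n≤k)

    -- The conjugate norm pⁿ of βⁿ tends to 0. All rounding errors in `Coordinates` are fixed linear
    -- forms in y and z, so this one estimate settles the four of them.
    linearForm-small : ∀ c₀ c₁ → Eventually
      (λ n → Small (c₀ * conjugate₀ (power n) + c₁ * conjugate₁ (power n)))
    linearForm-small c₀ c₁ = helper (^-unbounded (fromℕ 4 * K * D ⁻¹))
      where
      K : Carrier
      K = fromℕ 8 * (c₀ * c₀ * p + c₁ * c₁)
      small : ∀ n → fromℕ 4 * K * D ⁻¹ < β ^ n → Small (c₀ * conjugate₀ (power n) + c₁ * conjugate₁ (power n))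
      small n 4K/D<β^n = 4x²<1⇒small (*-cancelˡ-< 0<D
        (≤-<-trans 4DL²≤ (<-respʳ-≈ (sym (*-identityʳ D)) 4Kp^n<D)))
        where
        L = c₀ * conjugate₀ (power n) + c₁ * conjugate₁ (power n)
        4DL²≤ : D * (fromℕ 4 * (L * L)) ≤ fromℕ 4 * (K * p ^ n)
        4DL²≤ = ≤-respˡ-≈ (solve 3 (λ f D x → f :* (D :* x) := D :* (f :* x)) refl (fromℕ 4) D (L * L))
          (*-monoˡ-≤ (0≤-fromℕ 4) (≤-respʳ-≈ (*-congˡ (conjugateNorm-power n))
            (linearForm-bound c₀ c₁ (power n))))
        4Kp^n<D : fromℕ 4 * (K * p ^ n) < D
        4Kp^n<D = <-respˡ-≈
          (begin
            D * p ^ n * (fromℕ 4 * K * D ⁻¹)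
              ≈⟨ solve 5 (λ D x f K d → D :* x :* (f :* K :* d) := D :* d :* (f :* (K :* x)))
                refl D (p ^ n) (fromℕ 4) K (D ⁻¹) ⟩
            D * D ⁻¹ * (fromℕ 4 * (K * p ^ n))
              ≈⟨ trans (*-congʳ (*-inverseʳ D (0<⇒≉0 0<D))) (*-identityˡ _) ⟩
            fromℕ 4 * (K * p ^ n)                         ∎)
          (<-respʳ-≈
            (begin
              D * p ^ n * β ^ n
                ≈⟨ solve 3 (λ D x y → D :* x :* y := D :* (y :* x)) refl D (p ^ n) (β ^ n) ⟩
              D * (β ^ n * p ^ n)                         ≈⟨ trans (*-congˡ (β^*p^≈1 n)) (*-identityʳ D) ⟩
              D                                           ∎)
            (*-monoˡ-< (*-pos 0<D (0<p^ n)) 4K/D<β^n))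
      helper : ∃[ n ] fromℕ 4 * K * D ⁻¹ < β ^ n → Eventually
        (λ n → Small (c₀ * conjugate₀ (power n) + c₁ * conjugate₁ (power n)))
      helper (n₀ , <β^n₀) = n₀ , λ n n₀≤n → small n (<-≤-trans <β^n₀ (^-mono-≤ n₀≤n))

    0<δ : 0# < δ
    0<δ = *-cancelˡ-< (0<-fromℕ 3) (<-respˡ-≈ (sym (zeroʳ (fromℕ 4))) (<-respʳ-≈
      (solve 3 (λ β s p → (con (+ 4) :* p :- s :* s) :+ (con (+ 2) :* β :- s) :* (con (+ 2) :* β :- s)
        := con (+ 4) :* (β :* β :- β :* s :+ p)) refl β s p)
      (0<-+ 0<D (0≤-square _))))

    κ : Carrier
    κ = δ ⁻¹

    -- m = x + σ(x) + σ̄(x) is the trace of x = u + vβ + wβ²; as σ(x) and σ̄(x) are small, x ≈ δw and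
    -- (u : v : w) is close to (p : -s : 1).
    record Coordinates (m : ℤ) (x : Triple) : Set where
      constructor coordinates
      open Triple x
      field
        value-m : IsFloor (value x + ½) m
        fst-m   : IsFloor (p * κ * fromℤ m + ½) fst
        snd-m   : IsFloor (- s * κ * fromℤ m + ½) snd
        thd-m   : IsFloor (κ * fromℤ m + ½) thd

    trace : Triple → ℤ
    trace ⟨ u , v , w ⟩ = proj₁ (trace∈ℤ u v w)

    trace≈ : ∀ x → fromℤ (trace x) ≈ value x + (fromℕ 2 * conjugate₀ x + s * conjugate₁ x)
    trace≈ ⟨ u , v , w ⟩ = sym (proj₂ (trace∈ℤ u v w))

    private
      -- These are the differences x - m, pκm - u, -sκm - v and κm - w, rewritten by means of m = 3y
      -- + (β + s)z + δw and κδ = 1.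
      eventually-Small : ℕ → Set
      eventually-Small n =
        Small (- fromℕ 2 * y + - s * z) × Small ((p * κ * fromℕ 3 - 1#) * y + p * κ * (β + s) * z) ×
        Small (- s * κ * fromℕ 3 * y + (- s * κ * (β + s) - 1#) * z) × Small
          (κ * fromℕ 3 * y + κ * (β + s) * z)
        where
        y = conjugate₀ (power n)
        z = conjugate₁ (power n)

      small-resp : ∀ {x y} → x ≈ y → Small x → Small y
      small-resp x≈y (l , u) = <-respʳ-≈ x≈y l , <-respˡ-≈ x≈y u

      floor-+½ : ∀ {x} i {d} → d ≈ x - fromℤ i → Small d → IsFloor (x + ½) i
      floor-+½ i d≈ small = IsFloor-+½ i (proj₁ small′) (proj₂ small′)
        where small′ = small-resp d≈ small

    coordinates-power : Eventually (λ n → Coordinates (trace (power n)) (power n))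
    coordinates-power = helper
      (eventually-× (linearForm-small (- fromℕ 2) (- s))
        (eventually-× (linearForm-small (p * κ * fromℕ 3 - 1#) (p * κ * (β + s)))
      (eventually-× (linearForm-small (- s * κ * fromℕ 3) (- s * κ * (β + s) - 1#))
        (linearForm-small (κ * fromℕ 3) (κ * (β + s))))))
      where
      coords : ∀ x m → (let y = conjugate₀ x; z = conjugate₁ x in
        fromℤ m ≈ value x + (fromℕ 2 * y + s * z) →
        Small (- fromℕ 2 * y + - s * z) × Small ((p * κ * fromℕ 3 - 1#) * y + p * κ * (β + s) * z) ×
        Small (- s * κ * fromℕ 3 * y + (- s * κ * (β + s) - 1#) * z) × Small
          (κ * fromℕ 3 * y + κ * (β + s) * z) →
        Coordinates m x)
      coords ⟨ u , v , w ⟩ m m≈ (small , small₁ , small₂ , small₃) = coordinates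
        (floor-+½ m
          (begin
            - fromℕ 2 * y + - s * z
              ≈⟨ solve 4 (λ x s y z → :- con (+ 2) :* y :+ (:- s) :* z
                := x :- (x :+ (con (+ 2) :* y :+ s :* z))) refl (valueℝ U V W) s y z ⟩
            valueℝ U V W - (valueℝ U V W + (fromℕ 2 * y + s * z))              ≈⟨ +-congˡ (-‿cong m≈) ⟨
            valueℝ U V W - fromℤ m                                             ∎) small)
        (floor-+½ u
          (begin
            (p * κ * fromℕ 3 - 1#) * y + p * κ * (β + s) * z
              ≈⟨ solve 7 (λ p κ β s U W z →
                (p :* κ :* con (+ 3) :- con 1ℤ) :* (U :- p :* W) :+ p :* κ :* (β :+ s) :* z
              := p :* (κ :* (con (+ 3) :* (U :- p :* W) :+ (β :+ s) :* z) :+ W) :- U) refl p κ β s U W z ⟩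
            p * (κ * (fromℕ 3 * y + (β + s) * z) + W) - U                      ≈⟨ +-congʳ (*-congˡ κm≈) ⟨
            p * (κ * fromℤ m) - U                                              ≈⟨ +-congʳ (*-assoc _ _ _) ⟨
            p * κ * fromℤ m - U                                                ∎) small₁)
        (floor-+½ v
          (begin
            - s * κ * fromℕ 3 * y + (- s * κ * (β + s) - 1#) * z
              ≈⟨ solve 6 (λ κ β s y V W →
                (:- s) :* κ :* con (+ 3) :* y :+ ((:- s) :* κ :* (β :+ s) :- con 1ℤ) :* (V :+ s :* W)
              := (:- s) :* (κ :* (con (+ 3) :* y :+ (β :+ s) :* (V :+ s :* W)) :+ W) :- V) refl κ β s y V W ⟩
            - s * (κ * (fromℕ 3 * y + (β + s) * z) + W) - V                    ≈⟨ +-congʳ (*-congˡ κm≈) ⟨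
            - s * (κ * fromℤ m) - V                                            ≈⟨ +-congʳ (*-assoc _ _ _) ⟨
            - s * κ * fromℤ m - V                                              ∎) small₂)
        (floor-+½ w
          (begin
            κ * fromℕ 3 * y + κ * (β + s) * z
              ≈⟨ solve 6 (λ κ β s y z W → κ :* con (+ 3) :* y :+ κ :* (β :+ s) :* z
                := κ :* (con (+ 3) :* y :+ (β :+ s) :* z) :+ W :- W) refl κ β s y z W ⟩
            κ * (fromℕ 3 * y + (β + s) * z) + W - W                            ≈⟨ +-congʳ κm≈ ⟨
            κ * fromℤ m - W                                                    ∎) small₃)
        where
        U = fromℤ u
        V = fromℤ v
        W = fromℤ w
        y = U - p * W
        z = V + s * W
        κm≈ : κ * fromℤ m ≈ κ * (fromℕ 3 * y + (β + s) * z) + W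
        κm≈ = begin
          κ * fromℤ m
            ≈⟨ *-congˡ (trans m≈ (+-congʳ (value-identity U V W))) ⟩
          κ * ((y + β * z + δ * W) + (fromℕ 2 * y + s * z))
            ≈⟨ solve 7 (λ κ δ β s y z W → κ :* ((y :+ β :* z :+ δ :* W) :+ (con (+ 2) :* y :+ s :* z))
                := κ :* (con (+ 3) :* y :+ (β :+ s) :* z) :+ δ :* κ :* W)
              refl κ δ β s y z W ⟩
          κ * (fromℕ 3 * y + (β + s) * z) + δ * κ * W
            ≈⟨ +-congˡ (trans (*-congʳ (*-inverseʳ δ (0<⇒≉0 0<δ))) (*-identityˡ W)) ⟩
          κ * (fromℕ 3 * y + (β + s) * z) + W                                  ∎
      helper : Eventually eventually-Small → Eventually (λ n → Coordinates (trace (power n)) (power n))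
      helper (n₀ , small) = n₀ , λ n n₀≤n → coords (power n) (trace (power n)) (trace≈ (power n))
        (small n n₀≤n)

    -- The set of integers nearest to powers of β

    NearestPower : Pred ℤ 0ℓ
    NearestPower m = ∃[ n ] IsFloor (β ^ n + ½) m

    Initial : ℕ → Pred ℤ 0ℓ
    Initial K m = ∃[ i ] i ℕ.< K × m ≡ + i

    ¬Initial⇒≥ : ∀ {K m} → 0ℤ ℤ.≤ m → ¬ Initial K m → + K ℤ.≤ m
    ¬Initial⇒≥ {K} {+ n} _ ¬initial with n ℕₚ.<? K
    ... | yes n<K = ⊥-elim (¬initial (n , n<K , ≡.refl))
    ... | no  n≮K = ℤ.+≤+ (ℕₚ.≮⇒≥ n≮K)

    norm≈1⇒0<value : ∀ x → value x * conjugateNorm x ≈ 1# → 0# < value x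
    norm≈1⇒0<value x norm≈1 with <⊎≥ 0# (value x)
    ... | inj₁ 0<x = 0<x
    ... | inj₂ x≤0 = ⊥-elim (≤⇒≯ (≤-respˡ-≈ norm≈1
      (≤-respˡ-≈ (*-comm _ _) (≤-respʳ-≈ (zeroʳ _) (*-monoˡ-≤ (0≤conjugateNorm x) x≤0)))) 0<1)

    0<½ : 0# < ½
    0<½ = 0<-⁻¹ (0<-+ 0<1 (inj₁ 0<1))

    floor-nonNeg : ∀ {x m} → 0# < x → IsFloor x m → 0ℤ ℤ.≤ m
    floor-nonNeg {x} {m} 0<x (_ , x<1+m) = i<suc[j]⇒i≤j (fromℤ-cancel-< {0ℤ} {ℤ.suc m} (<-trans 0<x x<1+m))

    IsFloor-cong : ∀ {x y} m → x ≈ y → IsFloor x m → IsFloor y m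
    IsFloor-cong m x≈y (m≤x , x<1+m) = ≤-respʳ-≈ x≈y m≤x , <-respˡ-≈ x≈y x<1+m

    -- Norm 1 makes x positive, hence m non-negative; outside the initial segment m ≥ K, and K is
    -- chosen so large that rounding to m forces x > βᵏ, as `PowerClass⇒power` demands.
    large⇒power : ∀ {k} (5<β^k : fromℕ 5 < β ^ k) (char : CharacteristicPolynomial (k ℕ.+ k)) →
      let open Separation k 5<β^k char in
      ∀ K → β ^ k + ½ < fromℤ (+ K) → ∀ m x → value x * conjugateNorm x ≈ 1# → PowerClass x →
      IsFloor (value x + ½) m → ¬ Initial K m → NearestPower m
    large⇒power {k} 5<β^k char K β^k+½<K m x norm≈1 class floor ¬initial = helper
      (PowerClass⇒power x class norm≈1 β^k<x)
      where
      open Separation k 5<β^k char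
      0<x+½ : 0# < value x + ½
      0<x+½ = 0<-+ (norm≈1⇒0<value x norm≈1) (inj₁ 0<½)
      β^k+½<x+½ : β ^ k + ½ < value x + ½
      β^k+½<x+½ = <-≤-trans (<-≤-trans β^k+½<K
        (fromℤ-mono-≤ (¬Initial⇒≥ (floor-nonNeg {m = m} 0<x+½ floor) ¬initial))) (proj₁ floor)
      β^k<x : β ^ k < value x
      β^k<x = <-fromDifference (solve 3 (λ x y h → (y :+ h) :- (x :+ h) := y :- x) refl (β ^ k) (value x) ½)
        (<⇒0<difference β^k+½<x+½)
      helper : ∃[ n ] value x ≈ β ^ n → NearestPower m
      helper (n , x≈β^n) = n , IsFloor-cong m (+-congʳ x≈β^n) floor

    module _ {u v w : ℤ → ℤ}
      (u-floor : ∀ m → IsFloor (p * κ * fromℤ m + ½) (u m))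
      (v-floor : ∀ m → IsFloor (- s * κ * fromℤ m + ½) (v m))
      (w-floor : ∀ m → IsFloor (κ * fromℤ m + ½) (w m)) where

      coordinates-unique : ∀ {m x} → Coordinates m x → x ≡ ⟨ u m , v m , w m ⟩
      coordinates-unique {m} {⟨ x , y , z ⟩} (coordinates _ x-floor y-floor z-floor) = triple-≡
        (IsFloor-unique x (u m) refl x-floor (u-floor m)) (IsFloor-unique y (v m) refl y-floor (v-floor m))
        (IsFloor-unique z (w m) refl z-floor (w-floor m))

    set-≡ : ∀ {g : ℤ → ℤ} → GeneralisedPolynomial (λ n → fromℤ (g n)) →
            GeneralisedPolynomialSet (λ n → n ≡ g n)
    set-≡ {g} G = set-⇔
      (λ n n-g≈0 → fromℤ-injective (trans (solve 2 (λ x y → x := (x :- y) :+ y) refl (fromℤ n) (fromℤ (g n)))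
        (trans (+-congʳ n-g≈0) (+-identityˡ _))))
      (λ n n≡g → trans (+-congʳ (reflexive (≡.cong fromℤ n≡g))) (-‿inverseʳ _))
      (set-zeros β-irrational (subtract argument G) (λ n → integer-- (integer-fromℤ n) (integer-fromℤ (g n))))

    set-singleton : ∀ i → GeneralisedPolynomialSet (λ n → n ≡ i)
    set-singleton i = set-≡ (constant (fromℤ i))

    set-Initial : ∀ K → GeneralisedPolynomialSet (Initial K)
    set-Initial = set-⋃ {λ i m → m ≡ + i} (λ i → set-singleton (+ i))

    -- Only finitely many integers are concerned, so membership in `E` enters as one constant
    -- condition for each of them.
    set-Initial-∩ : ∀ K (E : Pred ℤ 0ℓ) → GeneralisedPolynomialSet (λ n → Initial K n × E n)
    set-Initial-∩ K E = set-⇔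
      (λ { _ (i , i<K , ≡.refl , i∈E) → (i , i<K , ≡.refl) , i∈E })
      (λ { _ ((i , i<K , ≡.refl) , i∈E) → i , i<K , ≡.refl , i∈E })
      (set-⋃ {λ i n → n ≡ + i × E (+ i)} (λ i → set-∩ {λ n → n ≡ + i} {λ _ → E (+ i)} (set-singleton (+ i))
        (set-constant (E (+ i)))) K)

    set-IsFloor : ∀ x → GeneralisedPolynomialSet (IsFloor x)
    set-IsFloor x = helper (floor x)
      where
      helper : ∃ (IsFloor x) → GeneralisedPolynomialSet (IsFloor x)
      helper (i , i-floor) = set-⇔ (λ { _ ≡.refl → i-floor })
        (λ m m-floor → IsFloor-unique m i refl m-floor i-floor) (set-singleton i)

    -- Two finite families of exceptions are added to the main condition: the integers below K,
    -- where x need not exceed βᵏ, and the exponents below n₀, for which X(m) need not give the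
    -- coordinates of βⁿ.
    set-NearestPower : GeneralisedPolynomialSet NearestPower
    set-NearestPower = step₁ (large-exponent (fromℕ 5))
      where
      step₁ : ∃[ k ] fromℕ 5 < β ^ k × CharacteristicPolynomial k → GeneralisedPolynomialSet NearestPower
      step₁ (k , 5<β^k , char) = step₂ (archimedean (β ^ k + ½)) coordinates-power
        (integerPart (add (scale (p * κ) argument) (constant ½)))
        (integerPart (add (scale (- s * κ) argument) (constant ½)))
        (integerPart (add (scale κ argument) (constant ½)))
        where
        open Separation k 5<β^k (doubled char)
        step₂ : ∃[ K ] β ^ k + ½ < fromℤ (+ K) → Eventually (λ n → Coordinates (trace (power n)) (power n)) →
                IntegerPart (λ m → p * κ * fromℤ m + ½) → IntegerPart (λ m → - s * κ * fromℤ m + ½) →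
                IntegerPart (λ m → κ * fromℤ m + ½) → GeneralisedPolynomialSet NearestPower
        step₂ (K , β^k+½<K) (n₀ , coords) (u , u-floor , U) (v , v-floor , V) (w , w-floor , W) =
          step₃ (integerPart (add valueX (constant ½)))
          where
          X : ℤ → Triple
          X m = ⟨ u m , v m , w m ⟩
          valueX : GeneralisedPolynomial (λ m → value (X m))
          valueX = add (add U (scale β V)) (scale (β * β) W)
          conjugateNormX : GeneralisedPolynomial (λ m → conjugateNorm (X m))
          conjugateNormX = add (add (add (add (add (mul U U) (mul (scale s U) V))
            (mul (scale (s * s - fromℕ 2 * p) U) W))
            (mul (scale p V) V)) (mul (scale (p * s) V) W)) (mul (scale (p * p) W) W)
          step₃ : IntegerPart (λ m → value (X m) + ½) → GeneralisedPolynomialSet NearestPower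
          step₃ (r , r-floor , R) = set-⇔ to from
            (set-∪ (set-∩ set-norm (set-∩ (set-PowerClass U V W) (set-∩ (set-≡ R) (set-∁ (set-Initial K)))))
              (set-∪ (set-Initial-∩ K NearestPower) (set-⋃ (λ n → set-IsFloor (β ^ n + ½)) n₀)))
            where
            set-norm : GeneralisedPolynomialSet (λ m → value (X m) * conjugateNorm (X m) - 1# ≈ 0#)
            set-norm = set-zeros β-irrational (subtract (mul valueX conjugateNormX) (constant 1#))
              (λ m → integer-- (norm∈ℤ (X m)) (integer-fromℕ 1))
            -- The equation between m and r(m) says that X(m) rounds back to m; otherwise X(m) could
            -- be a power of β to which m is not the nearest integer.
            Large : Pred ℤ 0ℓ
            Large m = value (X m) * conjugateNorm (X m) - 1# ≈ 0# × PowerClass (X m) × m ≡ r m × ¬ Initial K m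
            to : ∀ m → Large m ⊎ (Initial K m × NearestPower m) ⊎
              (∃[ n ] n ℕ.< n₀ × IsFloor (β ^ n + ½) m) → NearestPower m
            to m (inj₂ (inj₁ (_ , nearest)))     = nearest
            to m (inj₂ (inj₂ (n , _ , floor)))   = n , floor
            to m (inj₁ (norm , class , m≡r , ¬initial)) = large⇒power {k} 5<β^k (doubled char) K β^k+½<K m
              (X m) norm≈1 class
              (≡.subst (IsFloor (value (X m) + ½)) (≡.sym m≡r) (r-floor m)) ¬initial
              where
              norm≈1 : value (X m) * conjugateNorm (X m) ≈ 1#
              norm≈1 = trans (solve 1 (λ x → x := (x :- con 1ℤ) :+ con 1ℤ) refl _)
                (trans (+-congʳ norm) (+-identityˡ 1#))
            large : ∀ n m → IsFloor (β ^ n + ½) m → n₀ ℕ.≤ n → ¬ Initial K m → Large m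
            -- Since the trace of βⁿ is also the nearest integer to βⁿ, it equals m, and the
            -- coordinates computed from m are those of βⁿ.
            large n m floor n₀≤n ¬initial = subst-large
              (IsFloor-unique (trace (power n)) m (+-congʳ (value-power n))
                (Coordinates.value-m (coords n n₀≤n)) floor) (coords n n₀≤n)
              where
              norm : ∀ x → power n ≡ x → value x * conjugateNorm x - 1# ≈ 0#
              norm x ≡.refl = trans (+-congʳ
                (trans (*-cong (value-power n) (conjugateNorm-power n)) (β^*p^≈1 n))) (-‿inverseʳ 1#)
              nearest-value : ∀ x → power n ≡ x → IsFloor (value x + ½) m
              nearest-value x ≡.refl = IsFloor-cong m (+-congʳ (sym (value-power n))) floor
              subst-large : trace (power n) ≡ m → Coordinates (trace (power n)) (power n) → Large m
              subst-large trace≡m coords′ =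
                norm (X m) power≡X ,
                ≡.subst PowerClass power≡X (power-PowerClass n) ,
                IsFloor-unique m (r m) refl (nearest-value (X m) power≡X) (r-floor m) ,
                ¬initial
                where
                power≡X : power n ≡ X m
                power≡X = coordinates-unique {u} {v} {w} u-floor v-floor w-floor
                  (≡.subst (λ m → Coordinates m (power n)) trace≡m coords′)
            from : ∀ m → NearestPower m → Large m ⊎ (Initial K m × NearestPower m) ⊎
              (∃[ n ] n ℕ.< n₀ × IsFloor (β ^ n + ½) m)
            from m (n , floor) with n ℕₚ.<? n₀ | excludedMiddle (Initial K m)
            ... | yes n<n₀ | _            = inj₂ (inj₂ (n , n<n₀ , floor))
            ... | no _     | yes initial  = inj₂ (inj₁ (initial , n , floor))
            ... | no n≮n₀  | no ¬initial  = inj₁ (large n m floor (ℕₚ.≮⇒≥ n≮n₀) ¬initial)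

    set-values : (h : ℕ → ℤ) → (∀ n m → IsFloor (β ^ n + ½) m → m ≡ h n) →
                 (∀ n m → m ≡ h n → IsFloor (β ^ n + ½) m) → GeneralisedPolynomialSet (λ m → ∃[ n ] m ≡ h n)
    set-values h to from = set-⇔ (λ { m (n , floor) → n , to n m floor })
      (λ { m (n , m≡hn) → n , from n m m≡hn }) set-NearestPower

    set-nearest-powers : GeneralisedPolynomialSet (λ m → ∃[ n ] m ≡ ⟪ β ^ n ⟫)
    set-nearest-powers = set-values (λ n → ⟪ β ^ n ⟫) (λ n → IsFloor⇒≡⟪⟫ (β ^ n)) (λ n → ≡⟪⟫⇒IsFloor (β ^ n))

  -- From the unique real root to the data of the cubic field

  module UniqueRoot (a b : ℤ) {β : Carrier} (unique : IsUniqueRoot (cubic a b) β) (1<β : 1# < β) where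

    private
      -- Vieta: the two remaining roots have sum a - β and product 1/β.
      A s p : Carrier
      A = fromℤ a
      s = A - β
      p = β ⁻¹

      0<β : 0# < β
      0<β = <-trans 0<1 1<β

      βp≈1 : β * p ≈ 1#
      βp≈1 = *-inverseʳ β (0<⇒≉0 0<β)

      a≈ : A ≈ β + s
      a≈ = solve 2 (λ A β → A := β :+ (A :- β)) refl A β

      cubic≈ : ∀ x → cubic a b x ≈ x * x * x - A * (x * x) - fromℤ b * x - 1#
      cubic≈ x = +-congʳ (+-congʳ (+-cong
        (solve 1 (λ x → x :* (x :* (x :* con 1ℤ)) := x :* x :* x) refl x)
        (-‿cong (*-congˡ (*-congˡ (*-identityʳ x))))))

      b≈ : fromℤ b ≈ - (β * s + p)
      b≈ = *-cancelˡ-≈ (0<⇒≉0 0<β)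
        (begin
          β * fromℤ b
            ≈⟨ solve 3 (λ β A B → β :* B :=
              (β :* β :* β :- A :* (β :* β) :- con 1ℤ) :- (β :* β :* β :- A :* (β :* β) :- B :* β :- con 1ℤ))
              refl β A (fromℤ b) ⟩
          (β * β * β - A * (β * β) - 1#) - (β * β * β - A * (β * β) - fromℤ b * β - 1#)
              ≈⟨ +-congˡ (-‿cong
              (trans (sym (cubic≈ β)) (proj₁ unique))) ⟩
          (β * β * β - A * (β * β) - 1#) - 0#                    ≈⟨ +-congʳ (+-congˡ (-‿cong βp≈1)) ⟨
          (β * β * β - A * (β * β) - β * p) - 0#
            ≈⟨ solve 3 (λ β A p → (β :* β :* β :- A :* (β :* β) :- β :* p) :- con 0ℤ
              := β :* (:- (β :* (A :- β) :+ p))) refl β A p ⟩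
          β * - (β * s + p)                                      ∎)

      cubic-factored : ∀ x → cubic a b x ≈ (x - β) * (x * x - s * x + p)
      cubic-factored x = begin
        cubic a b x                                              ≈⟨ cubic≈ x ⟩
        x * x * x - A * (x * x) - fromℤ b * x - 1#
          ≈⟨ +-cong (+-cong (+-congˡ (-‿cong (*-congʳ a≈))) (-‿cong (*-congʳ b≈))) (-‿cong (sym βp≈1)) ⟩
        x * x * x - (β + s) * (x * x) - - (β * s + p) * x - β * p
          ≈⟨ solve 4 (λ x β s p → x :* x :* x :- (β :+ s) :* (x :* x) :- (:- (β :* s :+ p)) :* x :- β :* p
            := (x :- β) :* (x :* x :- s :* x :+ p)) refl x β s p ⟩
        (x - β) * (x * x - s * x + p)                            ∎

      quadratic-root : ∀ x → x * x - s * x + p ≈ 0# → x ≈ β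
      quadratic-root x x²-sx+p≈0 = proj₂ unique x
        (trans (cubic-factored x) (trans (*-congˡ x²-sx+p≈0) (zeroʳ _)))

      -- If the discriminant were non-negative, both roots of X² - sX + p would equal β, so that p = β².
      s²<4p : s * s < fromℕ 4 * p
      s²<4p with <⊎≥ (s * s) (fromℕ 4 * p)
      ... | inj₁ s²<4p = s²<4p
      ... | inj₂ 4p≤s² = ⊥-elim (helper (sqrt (s * s - fromℕ 4 * p) (≤⇒0≤difference 4p≤s²)))
        where
        root : ∀ e → e * e ≈ s * s - fromℕ 4 * p → ½ * (s + e) ≈ β
        root e e²≈ = quadratic-root (½ * (s + e)) (begin
          ½ * (s + e) * (½ * (s + e)) - s * (½ * (s + e)) + p
            ≈⟨ solve 4 (λ h s e p → h :* (s :+ e) :* (h :* (s :+ e)) :- s :* (h :* (s :+ e)) :+ p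
                 := h :* h :* (e :* e) :+ h :* (s :* s) :* (h :- con 1ℤ) :+ h :* s :* e :* (h :+ h :- con 1ℤ)
                   :+ p) refl ½ s e p ⟩
          ½ * ½ * (e * e) + ½ * (s * s) * (½ - 1#) + ½ * s * e * (½ + ½ - 1#) + p
            ≈⟨ +-congʳ (+-cong (+-cong (*-congˡ e²≈) (*-congˡ (+-congˡ (-‿cong (sym ½+½≈1)))))
              (*-congˡ (+-congʳ ½+½≈1))) ⟩
          ½ * ½ * (s * s - fromℕ 4 * p) + ½ * (s * s) * (½ - (½ + ½)) + ½ * s * e * (1# - 1#) + p
            ≈⟨ solve 4 (λ h s e p → h :* h :* (s :* s :- con (+ 4) :* p) :+ h :* (s :* s) :* (h :- (h :+ h))
              :+ h :* s :* e :* (con 1ℤ :- con 1ℤ) :+ p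
                 := p :- (h :+ h) :* (h :+ h) :* p) refl ½ s e p ⟩
          p - (½ + ½) * (½ + ½) * p
            ≈⟨ +-congˡ (-‿cong (*-congʳ (*-cong ½+½≈1 ½+½≈1))) ⟩
          p - 1# * 1# * p
            ≈⟨ solve 1 (λ p → p :- con 1ℤ :* con 1ℤ :* p := con 0ℤ) refl p ⟩
          0# ∎)
        helper : ¬ (∃[ e ] e * e ≈ s * s - fromℕ 4 * p)
        helper (e , e²≈) = irrefl β²≈p (<-trans (<-trans p<1 1<β) β<β²)
          where
          p<1 : p < 1#
          p<1 = *-cancelˡ-< 0<β (<-respˡ-≈ (sym βp≈1) (<-respʳ-≈ (sym (*-identityʳ β)) 1<β))
          β<β² : β < β * β
          β<β² = <-respˡ-≈ (*-identityʳ β) (*-monoˡ-< 0<β 1<β)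
          β²≈p : p ≈ β * β
          β²≈p = sym (begin
            β * β
              ≈⟨ *-cong (root e e²≈) (root (- e)
                (trans (solve 1 (λ e → (:- e) :* (:- e) := e :* e) refl e) e²≈)) ⟨
            ½ * (s + e) * (½ * (s + - e))
              ≈⟨ solve 3 (λ h s e → h :* (s :+ e) :* (h :* (s :+ (:- e))) := h :* h :* (s :* s :- e :* e))
                refl ½ s e ⟩
            ½ * ½ * (s * s - e * e)                   ≈⟨ *-congˡ (+-congˡ (-‿cong e²≈)) ⟩
            ½ * ½ * (s * s - (s * s - fromℕ 4 * p))
              ≈⟨ solve 3 (λ h s p → h :* h :* (s :* s :- (s :* s :- con (+ 4) :* p))
                := (h :+ h) :* (h :+ h) :* p) refl ½ s p ⟩
            (½ + ½) * (½ + ½) * p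
              ≈⟨ trans (*-congʳ (trans (*-cong ½+½≈1 ½+½≈1) (*-identityˡ 1#))) (*-identityˡ p) ⟩
            p                                         ∎)

    uniqueRoot-powers : GeneralisedPolynomialSet (λ k → ∃[ n ] k ≡ ⟪ β ^ n ⟫)
    uniqueRoot-powers = CubicField.set-nearest-powers a b β s p 1<β βp≈1 a≈ b≈ s²<4p

theorem6p21 : (ℝ : CompleteOrderedField) →
    let open Real ℝ in
    (a b : ℤ) →
    (0ℤ ℤ.≤ a × 0ℤ ℤ.≤ b × b ℤ.≤ a ℤ.+ 1ℤ) ⊎ (+ 2 ℤ.≤ a × b ≡ -1ℤ) →
    (β : Carrier) → IsUniqueRoot (cubic a b) β → 1# < β →
    GeneralisedPolynomialSet (λ k → ∃[ n ] k ≡ ⟪ β ^ n ⟫)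
theorem6p21 ℝ a b _ β unique 1<β = NearestPowers.UniqueRoot.uniqueRoot-powers ℝ a b unique 1<β
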